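{- Let $n\ge 2$ be a prime power, let $F=\{a_1,\dots,a_n\}$ be the field of order $n$ (with its elements listed in any order), and let $\alpha$ be a primitive element of $F$. For $i\neq j$ with $1\le i,j\le n$ let $M_{i,j}\in\{0,1,\dots,n-2\}$ be the discrete logarithm of $a_i-a_j$ to the base $\alpha$, i.e. $\alpha^{M_{i,j}}=a_i-a_j$. For $1\le i,j\le n+1$ define $$u^{(i)}_j=\begin{cases}0 & \text{if } i=j \text{ or } i=n+1 \text{ or } j=n+1,\\[2pt] \dfrac{M_{i,j}+\frac12}{n-1}-\dfrac12 & \text{otherwise,}\end{cases}$$ and $u^{(i)}=(u^{(i)}_1,\dots,u^{(i)}_{n+1})$. Then $u^{(i)}\in H_n$ and $u^{(i)}_i=0$ for every $i$, and the families of parallel lines $$L_i=u^{(i)}+A_n+\{t v^{(i)} : t\in\mathbb{R}\},\qquad 1\le i\le n+1,$$ have the following properties. (1) For each $i$, the projection of $L_i$ along $v^{(i)}$ to the hyperplane $\{x\in H_n : x_i=0\}$ of $H_n$ perpendicular to $v^{(i)}$ is a translate of the projection of $A_n^*$ along $v^{(i)}$ to the same hyperplane. (2) For all $i\ne j$ in $\{1,\dots,n+1\}$, the $n-1$ coordinates of $u^{(i)}-u^{(j)}$ other than the $i$th and the $j$th are uniformly distributed modulo 1, and the minimal distance between a line in $L_i$ and a line in $L_j$ equals $\sqrt{\frac{n(n-2)}{12(n-1)}}$, which is the largest value this minimal distance can take over all choices of vectors $u^{(i)},u^{(j)}\in H_n$ with $u^{(i)}_i=0$ and $u^{(j)}_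j=0$.
   Context: $H_n=\{x\in\mathbb{R}^{n+1} : \sum_{k} x_k=0\}$ with the Euclidean metric of $\mathbb{R}^{n+1}$. $A_n=\mathbb{Z}^{n+1}\cap H_n$. $A_n^*$ is the permutohedral lattice, consisting of all $x\in H_n$ with $x_k-x_l\in\mathbb{Z}$ for all $k,l\in\{1,\dots,n+1\}$. For $1\le i\le n+1$, $v^{(i)}\in H_n$ is the vector whose $i$th coordinate is $\frac{n}{n+1}$ and whose other coordinates are all $-\frac1{n+1}$. The set $L_i$ is regarded as a collection of lines parallel to $v^{(i)}$, namely the lines $u^{(i)}+a+\{t v^{(i)}: t\in\mathbb{R}\}$ with $a\in A_n$; "the minimal distance between a line in $L_i$ and a line in $L_j$" is the minimum of the Euclidean distance between a line of the first collection and a line of the second, over all such pairs. Real numbers $y_1,\dots,y_m$ are uniformly distributed modulo 1 if there is a real $c$ such that, up to reordering, $y_1,\dots,y_m$ are congruent modulo 1 to $c,\ c+\frac1m,\ \dots,\ c+\frac{m-1}{m}$. -}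

module Defs where

open import Level using (Level; _⊔_) renaming (suc to lsuc)
open import Algebra.Apartness.Bundles using (HeytingCommutativeRing; HeytingField)
open import Algebra.Bundles using (CommutativeRing; Semiring)
import Algebra.Apartness.Properties.HeytingCommutativeRing as HCRProperties
import Algebra.Definitions.RawMonoid as RawMonoidDefinitions
import Algebra.Definitions.RawSemiring as RawSemiringDefinitions
import Algebra.Properties.Ring as RingProperties
open import Data.Bool.Base using (if_then_else_)
open import Data.Empty using (⊥-elim)
open import Data.Fin.Base using (Fin; toℕ; punchOut)
open import Data.Fin.Permutation using (Permutation′; _⟨$⟩ʳ_)
open import Data.Fin.Properties using (_≟_; nonZeroIndex)
open import Data.Fin.Relation.Unary.Top using (view; ‵fromℕ; ‵inject₁)
open import Data.Integer.Base using (ℤ; +_; -[1+_])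
open import Data.Nat.Base as ℕ using (ℕ; zero; suc; 2+; NonZero; NonTrivial; _∸_)
open import Data.Nat.Primality using (Prime)
open import Data.Nat.Properties using (m*n≢0)
open import Data.Product.Base using (Σ; ∃; ∃-syntax; _×_; _,_; proj₁)
open import Data.Sum.Base using (_⊎_; inj₁; inj₂; [_,_]′)
open import Data.Vec.Functional using (Vector; removeAt)
open import Function.Bundles using (_⇔_; Bijection)
open import Relation.Binary.Core using (Rel)
open import Relation.Binary.PropositionalEquality using (_≡_; _≢_)
  renaming (setoid to ≡-setoid)
open import Relation.Binary.Structures using (IsStrictPartialOrder)
open import Relation.Nullary using (¬_; does)
open import Relation.Unary using (Pred; _∈_)

private
  variable
    a c f p ℓ ℓ₁ ℓ₂ : Level

PrimePower : Pred ℕ _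
PrimePower n = ∃[ q ] ∃[ k ] (Prime q × n ≡ q ℕ.^ suc k)

-- The coordinates of y other than the i-th and the j-th.
removeTwo : ∀ {A : Set a} {n} {i j : Fin (suc n)} → i ≢ j →
            Vector A (suc n) → Vector A (n ∸ 1)
removeTwo {n = zero}      i≢j y ()
removeTwo {n = suc _} {i} i≢j y = removeAt (removeAt y i) (punchOut i≢j)

------------------------------------------------------------------------
-- Finite fields

module _ (F : CommutativeRing c ℓ) where
  open CommutativeRing F
  open RawSemiringDefinitions (Semiring.rawSemiring semiring) using (_^_)

  IsField : Set (c ⊔ ℓ)
  IsField = ¬ (1# ≈ 0#) × (∀ x → ¬ (x ≈ 0#) → ∃[ y ] (x * y ≈ 1#))

  -- A bijection from Fin n lists the elements of F, each exactly once.
  Enumeration : ℕ → Set (c ⊔ ℓ)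
  Enumeration n = Bijection (≡-setoid (Fin n)) setoid

  -- A generator of the multiplicative group. In a finite field the powers
  -- with natural exponents already exhaust the cyclic group generated by α.
  IsPrimitiveElement : Pred Carrier (c ⊔ ℓ)
  IsPrimitiveElement α = ¬ (α ≈ 0#) × (∀ x → ¬ (x ≈ 0#) → ∃[ k ] (α ^ k ≈ x))

  -- Nothing is required of the diagonal entries of M.
  IsDifferenceLog : ∀ {n} → Enumeration n → Carrier →
                    (Fin n → Fin n → ℕ) → Set ℓ
  IsDifferenceLog {n} e α M = ∀ i j → i ≢ j →
    M i j ℕ.≤ n ∸ 2 × α ^ M i j ≈ to i - to j
    where open Bijection e using (to)

------------------------------------------------------------------------
-- The real numbers

-- The standard library has no real numbers, so ℝ enters through its
-- characterisation as the complete Archimedean ordered field. Completeness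
-- is the least-upper-bound property in its constructive form, for located
-- sets; classically every set is located.

module Order {A : Set c} (_<_ : Rel A ℓ₂) where

  infix 4 _≤_
  _≤_ : Rel A ℓ₂
  x ≤ y = ¬ (y < x)

  UpperBound : Pred A p → Pred A (c ⊔ ℓ₂ ⊔ p)
  UpperBound S b = ∀ x → x ∈ S → x ≤ b

  LowerBound : Pred A p → Pred A (c ⊔ ℓ₂ ⊔ p)
  LowerBound S b = ∀ x → x ∈ S → b ≤ x

  Located : Pred A p → Set (c ⊔ ℓ₂ ⊔ p)
  Located S = ∀ x y → x < y → (∃[ s ] (s ∈ S × x < s)) ⊎ UpperBound S y

  IsSupremum : Pred A p → Pred A (c ⊔ ℓ₂ ⊔ p)
  IsSupremum S s = UpperBound S s × (∀ b → UpperBound S b → s ≤ b)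

  IsInfimum : Pred A p → Pred A (c ⊔ ℓ₂ ⊔ p)
  IsInfimum S s = LowerBound S s × (∀ b → LowerBound S b → b ≤ s)

  IsMinimum : Pred A p → Pred A (c ⊔ ℓ₂ ⊔ p)
  IsMinimum S s = s ∈ S × LowerBound S s

  IsMaximum : Pred A p → Pred A (c ⊔ ℓ₂ ⊔ p)
  IsMaximum S s = s ∈ S × UpperBound S s

record Reals c ℓ₁ ℓ₂ : Set (lsuc (c ⊔ ℓ₁ ⊔ ℓ₂)) where
  infix 4 _<_
  field
    heytingField : HeytingField c ℓ₁ ℓ₂

  open HeytingField heytingField public

  commutativeRing : CommutativeRing c ℓ₁
  commutativeRing = HeytingCommutativeRing.commutativeRing heytingCommutativeRing

  open RawMonoidDefinitions (CommutativeRing.+-rawMonoid commutativeRing) public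
    using (sum) renaming (_×_ to _×ℕ_)

  fromℕ : ℕ → Carrier
  fromℕ n = n ×ℕ 1#

  field
    _<_                  : Rel Carrier ℓ₂
    isStrictPartialOrder : IsStrictPartialOrder _≈_ _<_
    <⇒#                  : ∀ {x y} → x < y → x # y
    #⇒<⊎>                : ∀ {x y} → x # y → x < y ⊎ y < x
    +-monoˡ-<            : ∀ {x y} z → x < y → x + z < y + z
    *-pos                : ∀ {x y} → 0# < x → 0# < y → 0# < x * y

  open Order _<_ public

  field
    archimedean : ∀ x → ∃[ n ] (x < fromℕ n)
    complete    : (S : Pred Carrier (c ⊔ ℓ₁ ⊔ ℓ₂)) →
                  (∃[ x ] (x ∈ S)) → (∃[ b ] UpperBound S b) → Located S →
                  ∃[ s ] IsSupremum S s

  private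
    module < = IsStrictPartialOrder isStrictPartialOrder
    module HCR = HCRProperties heytingCommutativeRing
    module RP = RingProperties (CommutativeRing.ring commutativeRing)

  0<1 : 0# < 1#
  0<1 = [ (λ 1<0 → ⊥-elim (<.irrefl refl (<.trans 1<0 (positive 1<0))))
        , (λ 0<1 → 0<1) ]′ (#⇒<⊎> HCR.1#0)
    where
    0<-1 : 1# < 0# → 0# < - 1#
    0<-1 1<0 = <.<-respʳ-≈ (+-identityˡ (- 1#))
      (<.<-respˡ-≈ (-‿inverseʳ 1#) (+-monoˡ-< (- 1#) 1<0))

    positive : 1# < 0# → 0# < 1#
    positive 1<0 = <.<-respʳ-≈
      (trans (RP.-1*x≈-x (- 1#)) (RP.-‿involutive 1#))
      (*-pos (0<-1 1<0) (0<-1 1<0))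

  0<fromℕ : ∀ n → 0# < fromℕ (suc n)
  0<fromℕ zero    = <.<-respʳ-≈ (sym (+-identityʳ 1#)) 0<1
  0<fromℕ (suc n) = <.trans (0<fromℕ n)
    (<.<-respˡ-≈ (+-identityˡ _) (+-monoˡ-< (fromℕ (suc n)) 0<1))

  infixl 7 _/_
  _/_ : Carrier → (n : ℕ) .{{_ : NonZero n}} → Carrier
  x / suc n = x * proj₁ (#⇒invertible (#-sym (<⇒# (0<fromℕ n))))

  fromℤ : ℤ → Carrier
  fromℤ (+ n)    = fromℕ n
  fromℤ -[1+ n ] = - fromℕ (suc n)

  IsInteger : Pred Carrier ℓ₁
  IsInteger x = ∃[ z ] (x ≈ fromℤ z)

  IsSqrt : Carrier → Pred Carrier (ℓ₁ ⊔ ℓ₂)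
  IsSqrt s d = 0# ≤ d × d * d ≈ s

  UniformModOne : ∀ {m} → Vector Carrier m → Set (c ⊔ ℓ₁)
  UniformModOne {m} y = ∃[ b ] Σ (Permutation′ m) λ π → ∀ k →
    IsInteger (y (π ⟨$⟩ʳ k) - (b + (fromℕ (toℕ k) / m) {{nonZeroIndex k}}))

------------------------------------------------------------------------
-- Lattices and lines in ℝⁿ⁺¹

module Euclidean (R : Reals c ℓ₁ ℓ₂) where
  open Reals R

  infixl 6 _+ᵛ_ _-ᵛ_
  infixl 7 _*ᵛ_
  infix  4 _≈ᵛ_

  _+ᵛ_ _-ᵛ_ : ∀ {m} → Vector Carrier m → Vector Carrier m → Vector Carrier m
  (x +ᵛ y) k = x k + y k
  (x -ᵛ y) k = x k - y k

  _*ᵛ_ : ∀ {m} → Carrier → Vector Carrier m → Vector Carrier m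
  (t *ᵛ x) k = t * x k

  _≈ᵛ_ : ∀ {m} → Rel (Vector Carrier m) ℓ₁
  x ≈ᵛ y = ∀ k → x k ≈ y k

  Line : ∀ {m} → Vector Carrier m → Vector Carrier m →
         Pred (Vector Carrier m) (c ⊔ ℓ₁)
  Line w d x = ∃[ t ] (x ≈ᵛ w +ᵛ t *ᵛ d)

  IsTranslateOf : ∀ {m} → Rel (Pred (Vector Carrier m) p) (c ⊔ ℓ₁ ⊔ p)
  IsTranslateOf S T = ∃[ w ] (∀ x → x ∈ S ⇔ (∃[ t ] (t ∈ T × x ≈ᵛ w +ᵛ t)))

  -- The image of S under the projection along d to P.
  Projection : ∀ {m} → Vector Carrier m → Pred (Vector Carrier m) ℓ₁ →
               Pred (Vector Carrier m) p → Pred (Vector Carrier m) (c ⊔ ℓ₁ ⊔ p)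
  Projection d P S y = ∃[ x ] (x ∈ S × y ∈ Line x d × y ∈ P)

  IsPointDistance : ∀ {m} → Vector Carrier m → Vector Carrier m →
                    Pred Carrier (ℓ₁ ⊔ ℓ₂)
  IsPointDistance x y = IsSqrt (sum λ k → (x k - y k) * (x k - y k))

  IsSetDistance : ∀ {m} → Pred (Vector Carrier m) p →
                  Pred (Vector Carrier m) p → Pred Carrier (c ⊔ ℓ₁ ⊔ ℓ₂ ⊔ p)
  IsSetDistance S T = IsInfimum λ d →
    ∃[ x ] ∃[ y ] (x ∈ S × y ∈ T × IsPointDistance x y d)

  module _ (n : ℕ) where

    H : Pred (Vector Carrier (suc n)) ℓ₁
    H x = sum x ≈ 0#

    A : Pred (Vector Carrier (suc n)) ℓ₁
    A x = x ∈ H × (∀ k → IsInteger (x k))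

    A* : Pred (Vector Carrier (suc n)) ℓ₁
    A* x = x ∈ H × (∀ k l → IsInteger (x k - x l))

    v : Fin (suc n) → Vector Carrier (suc n)
    v i j = if does (i ≟ j) then fromℕ n / suc n else - (1# / suc n)

    v⊥ : Fin (suc n) → Pred (Vector Carrier (suc n)) ℓ₁
    v⊥ i x = x ∈ H × x i ≈ 0#

    -- The union of the lines w + a + ℝ v⁽ⁱ⁾ with a ∈ A.
    L : Fin (suc n) → Vector Carrier (suc n) →
        Pred (Vector Carrier (suc n)) (c ⊔ ℓ₁)
    L i w x = ∃[ a ] (a ∈ A × x ∈ Line (w +ᵛ a) (v i))

    IsMinimalLineDistance : (i j : Fin (suc n)) (w z : Vector Carrier (suc n)) →
                            Pred Carrier (c ⊔ ℓ₁ ⊔ ℓ₂)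
    IsMinimalLineDistance i j w z = IsMinimum λ d →
      ∃[ a ] ∃[ b ] (a ∈ A × b ∈ A ×
        IsSetDistance (Line (w +ᵛ a) (v i)) (Line (z +ᵛ b) (v j)) d)

    AttainableMinimalDistance : (i j : Fin (suc n)) →
                                Pred Carrier (c ⊔ ℓ₁ ⊔ ℓ₂)
    AttainableMinimalDistance i j d = ∃[ w ] ∃[ z ]
      (w ∈ H × z ∈ H × w i ≈ 0# × z j ≈ 0# × IsMinimalLineDistance i j w z d)

    module _ .{{_ : NonTrivial n}} where

      n∸1-nonZero : NonZero (n ∸ 1)
      n∸1-nonZero = go n
        where
        go : ∀ k .{{_ : NonTrivial k}} → NonZero (k ∸ 1)
        go (2+ _) = _

      u : (Fin n → Fin n → ℕ) → Fin (suc n) → Vector Carrier (suc n)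
      u M i j with view i | view j
      ... | ‵fromℕ      | _           = 0#
      ... | ‵inject₁ _  | ‵fromℕ      = 0#
      ... | ‵inject₁ i′ | ‵inject₁ j′ =
        if does (i′ ≟ j′) then 0#
        else ((fromℕ (M i′ j′) + 1# / 2) / (n ∸ 1)) {{n∸1-nonZero}} - 1# / 2

      optimalSquaredDistance : Carrier
      optimalSquaredDistance =
        (fromℕ (n ℕ.* (n ∸ 2)) / (12 ℕ.* (n ∸ 1)))
          {{m*n≢0 12 (n ∸ 1) {{_}} {{n∸1-nonZero}}}}

{-# OPTIONS --safe #-}

-- Projecting away from v⁽ⁱ⁾ and v⁽ʲ⁾ shows that two lines u + ℝv⁽ⁱ⁾ and
-- w + ℝv⁽ʲ⁾ are as far apart as the m = n - 1 coordinates of u - w other than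
-- the i-th and the j-th are from their mean, and the lattice A moves these
-- coordinates by arbitrary integers. So the minimal distance is governed by
-- the minimum over z ∈ ℤᵐ of W(x + z), where W(x) = m Σ xₖ² - (Σ xₖ)².
--
-- If x is k/m up to order, integers and a constant, then 12 W(x + z) ≥ m² - 1,
-- because after expansion W(x + z) - W(k/m) is a sum of terms d² + d over the
-- differences d of the integers involved. Conversely, if x is itself minimal
-- and sorted, then lowering a suffix of x by 1 does not decrease W; this bounds
-- the suffix sums of x by those of k/m, and Abel summation gives
-- 12 W(x) ≤ m² - 1.
--
-- The coordinates of u⁽ⁱ⁾ - u⁽ʲ⁾ are uniformly distributed because
-- x ↦ (aᵢ - x) / (aⱼ - x) is injective and αᵐ = 1.
module Submission where

open import Algebra.Bundles using (CommutativeRing)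
import Algebra.Properties.AbelianGroup as AbelianGroupProperties
import Algebra.Properties.Ring as RingProperties
import Algebra.Properties.Semiring.Exp as SemiringExp
import Algebra.Properties.Semiring.Mult as SemiringMult
import Algebra.Properties.Semiring.Sum as SemiringSum
import Algebra.Solver.Ring as RingSolver
open import Algebra.Solver.Ring.AlmostCommutativeRing using
  (fromCommutativeRing; _-Raw-AlmostCommutative⟶_)
open import Data.Fin.Base as Fin using (Fin; zero; suc; toℕ; fromℕ<; inject₁; punchIn; punchOut)
open import Data.Fin.Permutation as Perm using (Permutation′; _⟨$⟩ʳ_; _⟨$⟩ˡ_; permutation)
import Data.Fin.Properties as Fin
open import Data.Fin.Relation.Unary.Top using (view; view-fromℕ; view-inject₁; ‵fromℕ; ‵inject₁)
open import Data.Integer.Base as ℤ using (ℤ; +_; -[1+_])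
import Data.Integer.Properties as ℤ
open import Data.Maybe.Base using (Maybe; just; nothing)
open import Data.Nat.Base as ℕ using (ℕ; zero; suc; 2+; NonZero; NonTrivial; z≤n; s≤s; _∸_)
open import Data.Nat.DivMod using (_%_; m≡m%n+[m/n]*n; m%n<n)
import Data.Nat.Properties as ℕ
open import Data.Product.Base using (∃; ∃-syntax; Σ-syntax; _×_; _,_; proj₁; proj₂)
open import Data.Sum.Base using (_⊎_; inj₁; inj₂)
open import Data.Vec.Functional using (Vector; insertAt; removeAt)
open import Data.Vec.Functional.Properties using
  (insertAt-lookup; insertAt-punchIn; removeAt-punchOut)
open import Function.Base using (_∘_; case_of_)
open import Function.Bundles using (Bijection; mk⇔)
open import Function.Definitions using (Injective)
open import Level using (Level; Lift; lift; _⊔_)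
open import Relation.Binary.Consequences using (dec⇒weaklyDec)
open import Relation.Binary.PropositionalEquality as ≡ using (_≡_; _≢_)
import Relation.Binary.Reasoning.Setoid as SetoidReasoning
open import Relation.Binary.Structures using (IsStrictPartialOrder)
open import Relation.Nullary using (¬_; contradiction; yes; no)
open import Relation.Unary using (Pred; _∈_)
open import Defs

-- The order of the reals is not decidable, and this shapes the argument. Since `x ≤ y` is a
-- negation, an inequality may be proved by classical case analysis, but a distance is a square root
-- and has to be constructed from completeness for located sets. For the same reason no minimiser
-- over the lattice is ever searched for: for the vectors u it is written down explicitly, and for
-- arbitrary competitors the assumed minimum already comes with a pair of lines that attains it.
--
-- For two of the first n indices, the last coordinate acts as the point at infinity of the Möbius
-- map, where the ratio is 1. It supplies the residue 0, which the n - 2 finite points miss, so that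
-- together the m coordinates fill all residues modulo m.
--
-- Scaling by m and by 12 keeps most of the identities polynomial, hence within reach of the ring
-- solver.

-- Integer coefficients for the ring solver, shared by the reals and the finite field

module IntegerSolver {c ℓ : Level} (CR : CommutativeRing c ℓ) where
  open CommutativeRing CR
  open AbelianGroupProperties +-abelianGroup using () renaming (⁻¹-∙-comm to -‿+-comm)
  open RingProperties ring using (-‿distribˡ-*; -‿distribʳ-*; -‿involutive; -0#≈0#)
  open SemiringMult semiring using (×-homo-+; ×1-homo-*) renaming (_×_ to _×ℕ_)
  open SetoidReasoning setoid

  -- Integers have decidable equality, which the carrier need not have; with them as coefficients
  -- the solver can cancel terms and compute with numerals.
  cast : ℤ → Carrier
  cast (+ n)    = n ×ℕ 1#
  cast -[1+ n ] = - (suc n ×ℕ 1#)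

  private
    cancel-1 : ∀ x y → (1# + x) - (1# + y) ≈ x - y
    cancel-1 x y = begin
      (1# + x) - (1# + y)    ≈⟨ +-cong (+-comm x 1#) (-‿+-comm 1# y) ⟨
      (x + 1#) + (- 1# - y)  ≈⟨ +-assoc x 1# (- 1# - y) ⟩
      x + (1# + (- 1# - y))  ≈⟨ +-congˡ (+-assoc 1# (- 1#) (- y)) ⟨
      x + ((1# - 1#) - y)    ≈⟨ +-congˡ (+-congʳ (-‿inverseʳ 1#)) ⟩
      x + (0# - y)           ≈⟨ +-congˡ (+-identityˡ (- y)) ⟩
      x - y                  ∎

  cast-⊖ : ∀ m n → cast (m ℤ.⊖ n) ≈ m ×ℕ 1# - n ×ℕ 1#
  cast-⊖ m zero = begin
    m ×ℕ 1#          ≈⟨ +-identityʳ _ ⟨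
    m ×ℕ 1# + 0#     ≈⟨ +-congˡ -0#≈0# ⟨
    m ×ℕ 1# - 0#     ∎
  cast-⊖ zero (suc n) = sym (+-identityˡ _)
  cast-⊖ (suc m) (suc n) = begin
    cast (suc m ℤ.⊖ suc n)     ≡⟨ ≡.cong cast (ℤ.[1+m]⊖[1+n]≡m⊖n m n) ⟩
    cast (m ℤ.⊖ n)             ≈⟨ cast-⊖ m n ⟩
    m ×ℕ 1# - n ×ℕ 1#            ≈⟨ cancel-1 _ _ ⟨
    suc m ×ℕ 1# - suc n ×ℕ 1#    ∎

  cast-+ : ∀ i j → cast (i ℤ.+ j) ≈ cast i + cast j
  cast-+ (+ m) (+ n)       = ×-homo-+ 1# m n
  cast-+ (+ m) -[1+ n ]    = cast-⊖ m (suc n)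
  cast-+ -[1+ m ] (+ n)    = trans (cast-⊖ n (suc m)) (+-comm _ _)
  cast-+ -[1+ m ] -[1+ n ] = begin
    - (suc (suc (m ℕ.+ n)) ×ℕ 1#)       ≡⟨ ≡.cong (λ k → - (suc k ×ℕ 1#)) (≡.sym (ℕ.+-suc m n)) ⟩
    - ((suc m ℕ.+ suc n) ×ℕ 1#)         ≈⟨ -‿cong (×-homo-+ 1# (suc m) (suc n)) ⟩
    - (suc m ×ℕ 1# + suc n ×ℕ 1#)        ≈⟨ -‿+-comm _ _ ⟨
    - (suc m ×ℕ 1#) - suc n ×ℕ 1#        ∎

  cast-- : ∀ i → cast (ℤ.- i) ≈ - cast i
  cast-- (+ zero)  = sym -0#≈0#
  cast-- (+ suc n) = refl
  cast-- -[1+ n ]  = sym (-‿involutive _)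

  private
    cast-pos-* : ∀ m j → cast (+ m ℤ.* j) ≈ m ×ℕ 1# * cast j
    cast-pos-* m (+ n) = begin
      cast (+ m ℤ.* + n)               ≡⟨ ≡.cong cast (ℤ.pos-* m n) ⟨
      (m ℕ.* n) ×ℕ 1#                   ≈⟨ ×1-homo-* m n ⟩
      m ×ℕ 1# * (n ×ℕ 1#)                ∎
    cast-pos-* m -[1+ n ] = begin
      cast (+ m ℤ.* -[1+ n ])          ≡⟨ ≡.cong cast (ℤ.neg-distribʳ-* (+ m) (+ suc n)) ⟨
      cast (ℤ.- (+ m ℤ.* + suc n))     ≈⟨ cast-- (+ m ℤ.* + suc n) ⟩
      - cast (+ m ℤ.* + suc n)         ≡⟨ ≡.cong (λ i → - cast i) (ℤ.pos-* m (suc n)) ⟨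
      - ((m ℕ.* suc n) ×ℕ 1#)           ≈⟨ -‿cong (×1-homo-* m (suc n)) ⟩
      - (m ×ℕ 1# * (suc n ×ℕ 1#))        ≈⟨ -‿distribʳ-* _ _ ⟩
      m ×ℕ 1# * - (suc n ×ℕ 1#)          ∎

  cast-* : ∀ i j → cast (i ℤ.* j) ≈ cast i * cast j
  cast-* (+ m)    j = cast-pos-* m j
  cast-* -[1+ m ] j = begin
    cast (-[1+ m ] ℤ.* j)              ≡⟨ ≡.cong cast (ℤ.neg-distribˡ-* (+ suc m) j) ⟨
    cast (ℤ.- (+ suc m ℤ.* j))         ≈⟨ cast-- (+ suc m ℤ.* j) ⟩
    - cast (+ suc m ℤ.* j)             ≈⟨ -‿cong (cast-pos-* (suc m) j) ⟩
    - (suc m ×ℕ 1# * cast j)            ≈⟨ -‿distribˡ-* _ _ ⟩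
    - (suc m ×ℕ 1#) * cast j            ∎

  -- The solver interprets the constant 1 as 1#, whereas cast (+ 1) is 1# + 0#.
  ⟦_⟧ℤ : ℤ → Carrier
  ⟦ + 1 ⟧ℤ = 1#
  ⟦ i   ⟧ℤ = cast i

  private
    ⟦⟧≈cast : ∀ i → ⟦ i ⟧ℤ ≈ cast i
    ⟦⟧≈cast (+ 0)             = refl
    ⟦⟧≈cast (+ 1)             = sym (+-identityʳ 1#)
    ⟦⟧≈cast (+ suc (suc _))   = refl
    ⟦⟧≈cast -[1+ _ ]          = refl

    morphism : ℤ.+-*-rawRing -Raw-AlmostCommutative⟶ fromCommutativeRing CR
    morphism = record
      { ⟦_⟧    = ⟦_⟧ℤ
      ; +-homo = λ i j → trans (⟦⟧≈cast (i ℤ.+ j))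
          (trans (cast-+ i j) (sym (+-cong (⟦⟧≈cast i) (⟦⟧≈cast j))))
      ; *-homo = λ i j → trans (⟦⟧≈cast (i ℤ.* j))
          (trans (cast-* i j) (sym (*-cong (⟦⟧≈cast i) (⟦⟧≈cast j))))
      ; -‿homo = λ i → trans (⟦⟧≈cast (ℤ.- i))
          (trans (cast-- i) (sym (-‿cong (⟦⟧≈cast i))))
      ; 0-homo = refl
      ; 1-homo = refl
      }

    ⟦_≟_⟧ : ∀ i j → Maybe (⟦ i ⟧ℤ ≈ ⟦ j ⟧ℤ)
    ⟦ i ≟ j ⟧ with dec⇒weaklyDec ℤ._≟_ i j
    ... | just ≡.refl = just refl
    ... | nothing     = nothing

  open RingSolver ℤ.+-*-rawRing (fromCommutativeRing CR) morphism ⟦_≟_⟧ public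
    using (solve; con; _:=_; _:+_; _:*_; _:-_; :-_)

-- Order and arithmetic of the constructive reals

module OrderedField {c ℓ₁ ℓ₂ : Level} (R : Reals c ℓ₁ ℓ₂) where
  open Reals R
  open IsStrictPartialOrder isStrictPartialOrder public using ()
    renaming (irrefl to <-irrefl; trans to <-trans; asym to <-asym; <-respʳ-≈ to <-respʳ; <-respˡ-≈
      to <-respˡ)
  open IntegerSolver commutativeRing public

  -- Takes the place of trichotomy: apartness is cotransitive in a Heyting field, and each apartness
  -- splits into the two strict inequalities.
  <-cotrans : ∀ {x y} → x < y → ∀ z → x < z ⊎ z < y
  <-cotrans x<y z with #-cotrans (<⇒# x<y) z
  ... | inj₁ x#z = case #⇒<⊎> x#z of λ where
    (inj₁ x<z) → inj₁ x<z
    (inj₂ z<x) → inj₂ (<-trans z<x x<y)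
  ... | inj₂ z#y = case #⇒<⊎> z#y of λ where
    (inj₁ z<y) → inj₂ z<y
    (inj₂ y<z) → inj₁ (<-trans x<y y<z)

  ≤-reflexive : ∀ {x y} → x ≈ y → x ≤ y
  ≤-reflexive x≈y = <-irrefl (sym x≈y)

  <⇒≤ : ∀ {x y} → x < y → x ≤ y
  <⇒≤ = <-asym

  ≤-trans : ∀ {x y z} → x ≤ y → y ≤ z → x ≤ z
  ≤-trans {y = y} x≤y y≤z z<x = case <-cotrans z<x y of λ where
    (inj₁ z<y) → y≤z z<y
    (inj₂ y<x) → x≤y y<x

  ≤-<-trans : ∀ {x y z} → x ≤ y → y < z → x < z
  ≤-<-trans {x} x≤y y<z = case <-cotrans y<z x of λ where
    (inj₁ y<x) → contradiction y<x x≤y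
    (inj₂ x<z) → x<z

  ≤-antisym : ∀ {x y} → x ≤ y → y ≤ x → x ≈ y
  ≤-antisym x≤y y≤x = proj₁ (tight _ _) λ x#y → case #⇒<⊎> x#y of λ where
    (inj₁ x<y) → y≤x x<y
    (inj₂ y<x) → x≤y y<x

  ≤-respʳ : ∀ {x y z} → y ≈ z → x ≤ y → x ≤ z
  ≤-respʳ y≈z x≤y = ≤-trans x≤y (≤-reflexive y≈z)

  ≤-respˡ : ∀ {x y z} → x ≈ y → x ≤ z → y ≤ z
  ≤-respˡ x≈y = ≤-trans (≤-reflexive (sym x≈y))

  -- Totality itself is not constructive; the double negation suffices wherever the goal is a
  -- negation, in particular an inequality `≤`.
  ≤-total-¬¬ : ∀ x y → ¬ ¬ (x ≤ y ⊎ y ≤ x)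
  ≤-total-¬¬ x y k = k (inj₁ λ y<x → k (inj₂ (<⇒≤ y<x)))

  <⇒0<- : ∀ {x y} → x < y → 0# < y - x
  <⇒0<- {x} x<y = <-respˡ (-‿inverseʳ x) (+-monoˡ-< (- x) x<y)

  0<-⇒< : ∀ {x y} → 0# < y - x → x < y
  0<-⇒< {x} {y} 0<y-x = <-respˡ (+-identityˡ x)
    (<-respʳ (solve 2 (λ x y → y :- x :+ x := y) refl x y) (+-monoˡ-< x 0<y-x))

  ≤⇒0≤- : ∀ {x y} → x ≤ y → 0# ≤ y - x
  ≤⇒0≤- {x} {y} x≤y y-x<0 = x≤y (0<-⇒<
    (<-respʳ (solve 2 (λ x y → con (+ 0) :- (y :- x) := x :- y) refl x y) (<⇒0<- y-x<0)))

  0≤-⇒≤ : ∀ {x y} → 0# ≤ y - x → x ≤ y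
  0≤-⇒≤ {x} {y} 0≤y-x y<x = 0≤y-x (0<-⇒<
    (<-respʳ (solve 2 (λ x y → x :- y := con (+ 0) :- (y :- x)) refl x y) (<⇒0<- y<x)))

  0<-+ˡ : ∀ {x y} → 0# < x → 0# ≤ y → 0# < x + y
  0<-+ˡ {x} {y} 0<x 0≤y = ≤-<-trans 0≤y (<-respˡ (+-identityˡ y) (+-monoˡ-< y 0<x))

  0≤-+ : ∀ {x y} → 0# ≤ x → 0# ≤ y → 0# ≤ x + y
  0≤-+ {x} {y} 0≤x 0≤y x+y<0 = case <-cotrans x+y<0 y of λ where
    (inj₁ x+y<y) → 0≤x (0<-⇒< (<-respʳ
      (solve 2 (λ x y → y :- (x :+ y) := con (+ 0) :- x) refl x y) (<⇒0<- x+y<y)))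
    (inj₂ y<0)   → 0≤y y<0

  +-mono-≤ : ∀ {x y u v} → x ≤ y → u ≤ v → x + u ≤ y + v
  +-mono-≤ {x} {y} {u} {v} x≤y u≤v = 0≤-⇒≤ (≤-respʳ
    (solve 4 (λ x y u v → (y :- x) :+ (v :- u) := (y :+ v) :- (x :+ u)) refl x y u v)
    (0≤-+ (≤⇒0≤- x≤y) (≤⇒0≤- u≤v)))

  private
    0<neg : ∀ {x} → x < 0# → 0# < - x
    0<neg x<0 = <-respʳ (+-identityˡ _) (<⇒0<- x<0)

  -- The sign of `x` cannot be decided, but either strict sign contradicts `x²<0`, and excluding
  -- both leaves `x ≈ 0#` by antisymmetry, which contradicts it too.
  0≤x² : ∀ x → 0# ≤ x * x
  0≤x² x x²<0 = 0≤-x (λ x<0 → contradiction x²<0 (<-asym (<-respʳ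
      (solve 1 (λ x → :- x :* :- x := x :* x) refl x) (*-pos (0<neg x<0) (0<neg x<0)))))
    where
    0≤-x : ¬ (0# ≤ x)
    0≤-x 0≤x = 0≮x (λ x≈0 → <-irrefl (trans (*-congʳ x≈0) (zeroˡ x)) x²<0)
      where
      0≮x : ¬ ¬ (x ≈ 0#)
      0≮x k = k (≤-antisym (λ 0<x → <-asym x²<0 (*-pos 0<x 0<x)) 0≤x)

  0≤-* : ∀ {x y} → 0# ≤ x → 0# ≤ y → 0# ≤ x * y
  0≤-* {x} {y} 0≤x 0≤y xy<0 = x≉0 (≤-antisym x≤0 0≤x)
    where
    x≉0 : ¬ (x ≈ 0#)
    x≉0 x≈0 = <-irrefl (trans (*-congʳ x≈0) (zeroˡ y)) xy<0
    x≤0 : x ≤ 0#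
    x≤0 0<x = <-irrefl (trans (*-congˡ (≤-antisym (λ 0<y → <-asym xy<0 (*-pos 0<x 0<y)) 0≤y))
      (zeroʳ x)) xy<0

  *-cancelˡ-0≤ : ∀ {x y} → 0# < x → 0# ≤ x * y → 0# ≤ y
  *-cancelˡ-0≤ {x} {y} 0<x 0≤xy y<0 = 0≤xy (0<-⇒< (<-respʳ
    (solve 2 (λ x y → x :* :- y := con (+ 0) :- x :* y) refl x y) (*-pos 0<x (0<neg y<0))))

  *-cancelˡ-≤ : ∀ {x y z} → 0# < x → x * y ≤ x * z → y ≤ z
  *-cancelˡ-≤ {x} {y} {z} 0<x xy≤xz = 0≤-⇒≤ (*-cancelˡ-0≤ 0<x (≤-respʳ
    (solve 3 (λ x y z → x :* z :- x :* y := x :* (z :- y)) refl x y z) (≤⇒0≤- xy≤xz)))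

  *-monoˡ-≤ : ∀ {x y z} → 0# ≤ x → y ≤ z → x * y ≤ x * z
  *-monoˡ-≤ {x} {y} {z} 0≤x y≤z = 0≤-⇒≤ (≤-respʳ
    (solve 3 (λ x y z → x :* (z :- y) := x :* z :- x :* y) refl x y z)
    (0≤-* 0≤x (≤⇒0≤- y≤z)))

  private
    difference-of-squares : ∀ x y → (y - x) * (y + x) ≈ y * y - x * x
    difference-of-squares = solve 2 (λ x y → (y :- x) :* (y :+ x) := y :* y :- x :* x) refl

  square-mono-≤ : ∀ {x y} → 0# ≤ x → x ≤ y → x * x ≤ y * y
  square-mono-≤ 0≤x x≤y = 0≤-⇒≤ (≤-respʳ (difference-of-squares _ _)
    (0≤-* (≤⇒0≤- x≤y) (0≤-+ (≤-trans 0≤x x≤y) 0≤x)))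

  square-mono-< : ∀ {x y} → 0# ≤ x → x < y → x * x < y * y
  square-mono-< 0≤x x<y = 0<-⇒< (<-respʳ (difference-of-squares _ _)
    (*-pos (<⇒0<- x<y) (0<-+ˡ (≤-<-trans 0≤x x<y) 0≤x)))

  square-cancel-≤ : ∀ {x y} → 0# ≤ y → x * x ≤ y * y → x ≤ y
  square-cancel-≤ 0≤y x²≤y² y<x = x²≤y² (square-mono-< 0≤y y<x)

  0≤1 : 0# ≤ 1#
  0≤1 = <⇒≤ 0<1

  0≤fromℕ : ∀ n → 0# ≤ fromℕ n
  0≤fromℕ zero    = ≤-reflexive refl
  0≤fromℕ (suc n) = <⇒≤ (0<fromℕ n)

  infix 9 ⅟_
  ⅟_ : (n : ℕ) .{{_ : NonZero n}} → Carrier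
  ⅟ n = 1# / n

  /≈*⅟ : ∀ x n .{{_ : NonZero n}} → x / n ≈ x * ⅟ n
  /≈*⅟ x (suc n) = *-congˡ (sym (*-identityˡ _))

  ⅟-inverse : ∀ n .{{_ : NonZero n}} → ⅟ n * fromℕ n ≈ 1#
  ⅟-inverse (suc n) = trans (*-congʳ (*-identityˡ _)) (trans (*-congˡ (sym
    (solve 1 (λ x → x :- con (+ 0) := x) refl (fromℕ (suc n)))))
    (proj₁ (proj₂ (#⇒invertible (#-sym (<⇒# (0<fromℕ n)))))))

  -- Invertibility is provided for the difference `x - 0#`, hence the rewriting. The inverse is
  -- apart from 0 because it is itself invertible, and it cannot be negative because its product
  -- with `x` is 1.
  0<⇒invertible : ∀ {x} → 0# < x → ∃[ y ] (0# < y × x * y ≈ 1#)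
  0<⇒invertible {x} 0<x = y , 0<y , xy≈1
    where
    x-0 = solve 1 (λ x → x :- con (+ 0) := x) refl
    x⁻¹ = #⇒invertible (#-sym (<⇒# 0<x))
    y = proj₁ x⁻¹
    yx≈1 : y * x ≈ 1#
    yx≈1 = trans (*-congˡ (sym (x-0 x))) (proj₁ (proj₂ x⁻¹))
    xy≈1 : x * y ≈ 1#
    xy≈1 = trans (*-comm x y) yx≈1
    y#0 : y # 0#
    y#0 = invertible⇒# (x , trans (*-congˡ (x-0 y)) xy≈1 , trans (*-congʳ (x-0 y)) yx≈1)
    0<y : 0# < y
    0<y = case #⇒<⊎> y#0 of λ where
      (inj₁ y<0) → contradiction y<0 (*-cancelˡ-0≤ 0<x (≤-respʳ (sym xy≈1) 0≤1))
      (inj₂ 0<y) → 0<y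

  0≤⅟ : ∀ n .{{_ : NonZero n}} → 0# ≤ ⅟ n
  0≤⅟ (suc n) = *-cancelˡ-0≤ (0<fromℕ n)
    (≤-respʳ (trans (sym (⅟-inverse (suc n))) (*-comm _ _)) 0≤1)

-- Integers among the reals

module Integers {c ℓ₁ ℓ₂ : Level} (R : Reals c ℓ₁ ℓ₂) where
  open Reals R hiding (zero)
  open OrderedField R

  fromℤ≈cast : ∀ z → fromℤ z ≈ cast z
  fromℤ≈cast (+ n)    = refl
  fromℤ≈cast -[1+ n ] = refl

  isInteger-resp : ∀ {x y} → x ≈ y → IsInteger x → IsInteger y
  isInteger-resp x≈y (z , x≈z) = z , trans (sym x≈y) x≈z

  isInteger-fromℕ : ∀ n → IsInteger (fromℕ n)
  isInteger-fromℕ n = + n , refl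

  isInteger-+ : ∀ {x y} → IsInteger x → IsInteger y → IsInteger (x + y)
  isInteger-+ (i , x≈i) (j , y≈j) = i ℤ.+ j , trans
    (+-cong (trans x≈i (fromℤ≈cast i)) (trans y≈j (fromℤ≈cast j)))
    (trans (sym (cast-+ i j)) (sym (fromℤ≈cast (i ℤ.+ j))))

  isInteger-neg : ∀ {x} → IsInteger x → IsInteger (- x)
  isInteger-neg (i , x≈i) = ℤ.- i , trans (-‿cong (trans x≈i (fromℤ≈cast i)))
    (trans (sym (cast-- i)) (sym (fromℤ≈cast (ℤ.- i))))

  isInteger-- : ∀ {x y} → IsInteger x → IsInteger y → IsInteger (x - y)
  isInteger-- ix iy = isInteger-+ ix (isInteger-neg iy)

  isInteger-sum : ∀ {m} {x : Vector Carrier m} → (∀ k → IsInteger (x k)) → IsInteger (sum x)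
  isInteger-sum {zero}  ix = isInteger-fromℕ 0
  isInteger-sum {suc m} ix = isInteger-+ (ix zero) (isInteger-sum (ix ∘ suc))

  -- The product x (x + 1) is negative only strictly between -1 and 0. At the negative integer -(1 +
  -- n) it takes the value n² + n.
  isInteger⇒0≤x²+x : ∀ {x} → IsInteger x → 0# ≤ x * x + x
  isInteger⇒0≤x²+x (+ n , x≈n) = ≤-respʳ (sym (+-cong (*-cong x≈n x≈n) x≈n))
    (0≤-+ (0≤x² (fromℕ n)) (0≤fromℕ n))
  isInteger⇒0≤x²+x (-[1+ n ] , x≈n) = ≤-respʳ
    (trans (solve 1 (λ N → N :* N :+ N := :- (con (+ 1) :+ N) :* :- (con (+ 1) :+ N) :+ :-
      (con (+ 1) :+ N)) refl (fromℕ n))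
      (sym (+-cong (*-cong x≈n x≈n) x≈n)))
    (0≤-+ (0≤x² (fromℕ n)) (0≤fromℕ n))

-- Square roots from completeness

module SquareRoot {c ℓ₁ ℓ₂ : Level} (R : Reals c ℓ₁ ℓ₂) where
  open Reals R hiding (zero)
  open OrderedField R
  open SetoidReasoning setoid

  private
    half : ∃[ h ] (0# < h × fromℕ 2 * h ≈ 1#)
    half = 0<⇒invertible (0<fromℕ 1)
    h = proj₁ half

    midpoint : Carrier → Carrier → Carrier
    midpoint x y = h * (x + y)

    midpoint-identity : ∀ x → h * (x + x) ≈ x
    midpoint-identity x = trans (solve 2 (λ h x → h :* (x :+ x) := con (+ 2) :* h :* x) refl h x)
      (trans (*-congʳ (proj₂ (proj₂ half))) (*-identityˡ x))

    <-midpoint : ∀ {x y} → x < y → x < midpoint x y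
    <-midpoint {x} {y} x<y = 0<-⇒< (<-respʳ
      (trans (solve 3 (λ h x y → h :* (y :- x) := h :* (x :+ y) :- h :* (x :+ x)) refl h x y)
        (+-congˡ (-‿cong (midpoint-identity x))))
      (*-pos (proj₁ (proj₂ half)) (<⇒0<- x<y)))

    midpoint-< : ∀ {x y} → x < y → midpoint x y < y
    midpoint-< {x} {y} x<y = 0<-⇒< (<-respʳ
      (trans (solve 3 (λ h x y → h :* (y :- x) := h :* (y :+ y) :- h :* (x :+ y)) refl h x y)
        (+-congʳ (midpoint-identity y)))
      (*-pos (proj₁ (proj₂ half)) (<⇒0<- x<y)))

    divided : ∀ p δ {t} → p * t ≈ 1# → δ * t * p ≈ δ
    divided p δ {t} pt≈1 = trans (solve 3 (λ p δ t → δ :* t :* p := δ :* (p :* t)) refl p δ t)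
      (trans (*-congˡ pt≈1) (*-identityʳ δ))

  -- The square root of q is the supremum of the x that are negative or have
  -- x² < q; admitting all negative x makes this set inhabited when q ≈ 0#.
  module _ {q : Carrier} (0≤q : 0# ≤ q) where
    private
      S : Pred Carrier (c ⊔ ℓ₁ ⊔ ℓ₂)
      S x = Lift (c ⊔ ℓ₁) (x < 0# ⊎ x * x < q)

      bounded : ∀ {y} → 0# ≤ y → q ≤ y * y → UpperBound S y
      bounded 0≤y q≤y² s (lift (inj₁ s<0))  y<s = 0≤y (<-trans y<s s<0)
      bounded 0≤y q≤y² s (lift (inj₂ s²<q)) y<s = q≤y² (<-trans (square-mono-< 0≤y y<s) s²<q)

      inhabited : ∃[ x ] (x ∈ S)
      inhabited = - 1# , lift (inj₁ (0<-⇒< (<-respʳ (solve 0 (con (+ 1)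
        := con (+ 0) :- (:- con (+ 1))) refl) 0<1)))

      aboveBound : ∃[ b ] UpperBound S b
      aboveBound = q + 1# , bounded (0≤-+ 0≤q 0≤1) (0≤-⇒≤ (≤-respʳ
        (solve 1 (λ q → q :* q :+ q :+ con (+ 1)
          := (q :+ con (+ 1)) :* (q :+ con (+ 1)) :- q) refl q)
        (0≤-+ (0≤-+ (0≤x² q) 0≤q) 0≤1)))

      -- Comparing q with m² < y² decides.
      located-pos : ∀ {x m y} → x < m → 0# ≤ m → m < y → (∃[ s ] (s ∈ S × x < s)) ⊎ UpperBound S y
      located-pos {x} {m} {y} x<m 0≤m m<y = case <-cotrans (square-mono-< 0≤m m<y) q of λ where
        (inj₁ m²<q) → inj₁ (m , lift (inj₂ m²<q) , x<m)
        (inj₂ q<y²) → inj₂ (bounded (<⇒≤ (≤-<-trans 0≤m m<y)) (<⇒≤ q<y²))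

      located : Located S
      located x y x<y = case <-cotrans x<y 0# of λ where
        (inj₁ x<0) → inj₁ (midpoint x 0# , lift (inj₁ (midpoint-< x<0)) , <-midpoint x<0)
        -- The test point must be nonnegative and lie strictly between `x` and `y`: the midpoint of
        -- `x` and `y` if `x` is positive, and half of `y` if `x` lies below that.
        (inj₂ 0<y) → case <-cotrans (<-midpoint 0<y) x of λ where
          (inj₁ 0<x) → located-pos (<-midpoint x<y) (<⇒≤ (<-trans 0<x (<-midpoint x<y)))
            (midpoint-< x<y)
          (inj₂ x<m) → located-pos x<m (<⇒≤ (<-midpoint 0<y)) (midpoint-< 0<y)

      supremum = complete S inhabited aboveBound located
      s = proj₁ supremum
      upper = proj₁ (proj₂ supremum)
      least = proj₂ (proj₂ supremum)

      0≤s : 0# ≤ s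
      0≤s s<0 = upper (midpoint s 0#) (lift (inj₁ (midpoint-< s<0))) (<-midpoint s<0)

      q≤s² : q ≤ s * s
      q≤s² s²<q = upper (s + ε) (lift (inj₂ s+ε²<q))
        (0<-⇒< (<-respʳ (solve 2 (λ s ε → ε := s :+ ε :- s) refl s ε) 0<ε))
        where
        δ = q - s * s
        0<δ = <⇒0<- s²<q
        -- With ε = δ / (1 + 2s + δ) the defect q - (s + ε)² equals ε + ε² (2s + δ), which is
        -- positive. The summand `δ` in `p` forces ε < 1, so that ε² cannot outweigh ε.
        p = 1# + s + s + δ
        inverse = 0<⇒invertible (0<-+ˡ (0<-+ˡ (0<-+ˡ 0<1 0≤s) 0≤s) (<⇒≤ 0<δ))
        ε = δ * proj₁ inverse
        0<ε = *-pos 0<δ (proj₁ (proj₂ inverse))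
        δ≈εp : δ ≈ ε * p
        δ≈εp = sym (divided p δ (proj₂ (proj₂ inverse)))
        slack : ε + ε * ε * (s + s + δ) ≈ q - (s + ε) * (s + ε)
        slack = begin
          ε + ε * ε * (s + s + δ)
            ≈⟨ solve 3 (λ ε s δ → ε :+ ε :* ε :* (s :+ s :+ δ)
            := ε :+ ε :* (ε :* (con (+ 1) :+ s :+ s :+ δ) :- ε)) refl ε s δ ⟩
          ε + ε * (ε * p - ε)                   ≈⟨ +-congˡ (*-congˡ (+-congʳ δ≈εp)) ⟨
          ε + ε * (δ - ε)                       ≈⟨ solve 3 (λ ε s δ → ε :+ ε :* (δ :- ε)
            := ε :* (con (+ 1) :+ s :+ s :+ δ) :- (s :+ s) :* ε :- ε :* ε) refl ε s δ ⟩
          ε * p - (s + s) * ε - ε * ε           ≈⟨ +-congʳ (+-congʳ δ≈εp) ⟨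
          δ - (s + s) * ε - ε * ε
            ≈⟨ solve 3 (λ q s ε → q :- s :* s :- (s :+ s) :* ε :- ε :* ε
            := q :- (s :+ ε) :* (s :+ ε)) refl q s ε ⟩
          q - (s + ε) * (s + ε)                 ∎
        s+ε²<q : (s + ε) * (s + ε) < q
        s+ε²<q = 0<-⇒< (<-respʳ slack (0<-+ˡ 0<ε (0≤-* (0≤x² ε) (0≤-+ (0≤-+ 0≤s 0≤s) (<⇒≤ 0<δ)))))

      s²≤q : s * s ≤ q
      s²≤q q<s² = least (s - ε) (bounded 0≤s-ε q≤s-ε²)
        (0<-⇒< (<-respʳ (solve 2 (λ s ε → ε := s :- (s :- ε)) refl s ε) 0<ε))
        where
        δ = s * s - q
        0<δ = <⇒0<- q<s²
        -- Here ε² helps, so `δ` can be left out of `p`: (s - ε)² - q = ε + ε². Moreover p (s - ε) =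
        -- s + s² + q, so `s - ε` stays nonnegative.
        p = 1# + s + s
        0<p = 0<-+ˡ (0<-+ˡ 0<1 0≤s) 0≤s
        inverse = 0<⇒invertible 0<p
        ε = δ * proj₁ inverse
        0<ε = *-pos 0<δ (proj₁ (proj₂ inverse))
        εp≈δ : ε * p ≈ δ
        εp≈δ = divided p δ (proj₂ (proj₂ inverse))
        0≤s-ε : 0# ≤ s - ε
        0≤s-ε = *-cancelˡ-0≤ 0<p (≤-respʳ (begin
          s + s * s + q          ≈⟨ solve 2 (λ s q → s :+ s :* s :+ q
            := (con (+ 1) :+ s :+ s) :* s :- (s :* s :- q)) refl s q ⟩
          p * s - δ              ≈⟨ +-congˡ (-‿cong εp≈δ) ⟨
          p * s - ε * p          ≈⟨ solve 3 (λ p s ε → p :* s :- ε :* p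
            := p :* (s :- ε)) refl p s ε ⟩
          p * (s - ε)            ∎) (0≤-+ (0≤-+ 0≤s (0≤x² s)) 0≤q))
        q≤s-ε² : q ≤ (s - ε) * (s - ε)
        q≤s-ε² = 0≤-⇒≤ (≤-respʳ (begin
          ε + ε * ε                             ≈⟨ solve 2 (λ s ε → ε :+ ε :* ε
            := ε :* (con (+ 1) :+ s :+ s) :- (s :+ s) :* ε :+ ε :* ε) refl s ε ⟩
          ε * p - (s + s) * ε + ε * ε           ≈⟨ +-congʳ (+-congʳ εp≈δ) ⟩
          δ - (s + s) * ε + ε * ε
            ≈⟨ solve 3 (λ q s ε → s :* s :- q :- (s :+ s) :* ε :+ ε :* ε
            := (s :- ε) :* (s :- ε) :- q) refl q s ε ⟩
          (s - ε) * (s - ε) - q                 ∎) (0≤-+ (<⇒≤ 0<ε) (0≤x² ε)))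

    squareRoot : ∃ (IsSqrt q)
    squareRoot = s , 0≤s , ≤-antisym s²≤q q≤s²

-- Finite sums and the dispersion form

module Sums {c ℓ₁ ℓ₂ : Level} (R : Reals c ℓ₁ ℓ₂) where
  open Reals R hiding (zero)
  open OrderedField R
  open CommutativeRing commutativeRing using (semiring)
  open SemiringSum semiring public using (sum-cong-≋; ∑-distrib-+; *-distribˡ-sum; sum-remove;
    sum-permute; sum-replicate)
  open SemiringMult semiring public using (×-assoc-*; ×-congʳ; ×-homo-+; ×1-homo-*)

  ×ℕ≈* : ∀ n x → n ×ℕ x ≈ fromℕ n * x
  ×ℕ≈* n x = sym (trans (×-assoc-* n 1# x) (×-congʳ n (*-identityˡ x)))

  sum-const : ∀ m x → sum {m} (λ _ → x) ≈ fromℕ m * x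
  sum-const m x = trans (sum-replicate m) (×ℕ≈* m x)

  sum-neg : ∀ {m} (x : Vector Carrier m) → sum (λ k → - x k) ≈ - sum x
  sum-neg {zero}  x = solve 0 (con (+ 0) := :- con (+ 0)) refl
  sum-neg {suc m} x = trans (+-congˡ (sum-neg (x ∘ suc)))
    (solve 2 (λ a b → :- a :+ :- b := :- (a :+ b)) refl (x zero) (sum (x ∘ suc)))

  sum-- : ∀ {m} (x y : Vector Carrier m) → sum (λ k → x k - y k) ≈ sum x - sum y
  sum-- x y = trans (∑-distrib-+ x (λ k → - y k)) (+-congˡ (sum-neg y))

  0≤sum : ∀ {m} {x : Vector Carrier m} → (∀ k → 0# ≤ x k) → 0# ≤ sum x
  0≤sum {zero}  0≤x = ≤-reflexive refl
  0≤sum {suc m} 0≤x = 0≤-+ (0≤x zero) (0≤sum (0≤x ∘ suc))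

-- m times the sum of the squared deviations of x₁, …, xₘ from their mean, and
-- its polarisation.
module Dispersion {c ℓ₁ ℓ₂ : Level} (R : Reals c ℓ₁ ℓ₂) where
  open Reals R hiding (zero)
  open OrderedField R
  open Euclidean R using (_+ᵛ_; _-ᵛ_; _*ᵛ_; _≈ᵛ_)
  open Integers R
  open Sums R
  open SetoidReasoning setoid

  private
    _·_ : ∀ {m} → Vector Carrier m → Vector Carrier m → Carrier
    x · y = sum (λ k → x k * y k)

  covariance : ∀ {m} → Vector Carrier m → Vector Carrier m → Carrier
  covariance {m} x y = fromℕ m * x · y - sum x * sum y

  dispersion : ∀ {m} → Vector Carrier m → Carrier
  dispersion x = covariance x x

  private
    ·-comm : ∀ {m} (x y : Vector Carrier m) → x · y ≈ y · x
    ·-comm x y = sum-cong-≋ (λ k → *-comm (x k) (y k))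

    ·-+ʳ : ∀ {m} (x y z : Vector Carrier m) → x · (y +ᵛ z) ≈ x · y + x · z
    ·-+ʳ x y z = trans (sum-cong-≋ (λ k → distribˡ (x k) (y k) (z k)))
      (∑-distrib-+ (λ k → x k * y k) (λ k → x k * z k))

    ·-*ʳ : ∀ {m} (x y : Vector Carrier m) t → x · (t *ᵛ y) ≈ t * x · y
    ·-*ʳ x y t = trans (sum-cong-≋ (λ k → solve 3 (λ x t y → x :* (t :* y)
      := t :* (x :* y)) refl (x k) t (y k)))
      (sym (*-distribˡ-sum t (λ k → x k * y k)))

  covariance-cong : ∀ {m} {x x′ y y′ : Vector Carrier m} → x ≈ᵛ x′ → y ≈ᵛ y′ → covariance x y
    ≈ covariance x′ y′
  covariance-cong x≈x′ y≈y′ = +-cong (*-congˡ (sum-cong-≋ (λ k → *-cong (x≈x′ k) (y≈y′ k))))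
    (-‿cong (*-cong (sum-cong-≋ x≈x′) (sum-cong-≋ y≈y′)))

  dispersion-cong : ∀ {m} {x y : Vector Carrier m} → x ≈ᵛ y → dispersion x ≈ dispersion y
  dispersion-cong x≈y = covariance-cong x≈y x≈y

  covariance-comm : ∀ {m} (x y : Vector Carrier m) → covariance x y ≈ covariance y x
  covariance-comm x y = +-cong (*-congˡ (·-comm x y)) (-‿cong (*-comm (sum x) (sum y)))

  covariance-+ʳ : ∀ {m} (x y z : Vector Carrier m) → covariance x (y +ᵛ z)
    ≈ covariance x y + covariance x z
  covariance-+ʳ {m} x y z = trans (+-cong (*-congˡ (·-+ʳ x y z))
    (-‿cong (*-congˡ (∑-distrib-+ y z))))
    (solve 6 (λ M a b s t u → M :* (a :+ b) :- s :* (t :+ u)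
      := (M :* a :- s :* t) :+ (M :* b :- s :* u)) refl
      (fromℕ m) (x · y) (x · z) (sum x) (sum y) (sum z))

  covariance-*ʳ : ∀ {m} (x y : Vector Carrier m) t → covariance x (t *ᵛ y) ≈ t * covariance x y
  covariance-*ʳ {m} x y t = trans (+-cong (*-congˡ (·-*ʳ x y t))
    (-‿cong (*-congˡ (sym (*-distribˡ-sum t y)))))
    (solve 5 (λ M t a b c → M :* (t :* a) :- b :* (t :* c)
      := t :* (M :* a :- b :* c)) refl (fromℕ m) t (x · y) (sum x) (sum y))

  covariance-+ˡ : ∀ {m} (x y z : Vector Carrier m) → covariance (x +ᵛ y) z
    ≈ covariance x z + covariance y z
  covariance-+ˡ x y z = trans (covariance-comm (x +ᵛ y) z)
    (trans (covariance-+ʳ z x y) (+-cong (covariance-comm z x) (covariance-comm z y)))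

  covariance-*ˡ : ∀ {m} (x y : Vector Carrier m) t → covariance (t *ᵛ x) y ≈ t * covariance x y
  covariance-*ˡ x y t = trans (covariance-comm (t *ᵛ x) y)
    (trans (covariance-*ʳ y x t) (*-congˡ (covariance-comm y x)))

  dispersion-+ : ∀ {m} (x y : Vector Carrier m) →
                 dispersion (x +ᵛ y) ≈ dispersion x + (dispersion y + fromℕ 2 * covariance x y)
  dispersion-+ x y = trans (covariance-+ʳ (x +ᵛ y) x y)
    (trans (+-cong (covariance-+ˡ x y x) (covariance-+ˡ x y y))
    (trans (+-congʳ (+-congˡ (covariance-comm y x)))
    (solve 3 (λ a b c → (a :+ c) :+ (c :+ b) := a :+ (b :+ con (+ 2) :* c)) refl (dispersion x)
      (dispersion y) (covariance x y))))

  dispersion-* : ∀ {m} t (x : Vector Carrier m) → dispersion (t *ᵛ x) ≈ t * t * dispersion x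
  dispersion-* t x = trans (covariance-*ˡ x (t *ᵛ x) t)
    (trans (*-congˡ (covariance-*ʳ x x t)) (sym (*-assoc t t _)))

  -- Constant vectors lie in the radical of the form, so only deviations from the mean count.
  covariance-constʳ : ∀ {m} (x : Vector Carrier m) b → covariance x (λ _ → b) ≈ 0#
  covariance-constʳ {m} x b = begin
    fromℕ m * sum (λ k → x k * b) - sum x * sum {m} (λ _ → b)
      ≈⟨ +-cong (*-congˡ (trans (sum-cong-≋ (λ k → *-comm (x k) b)) (sym (*-distribˡ-sum b x))))
         (-‿cong (*-congˡ (sum-const m b))) ⟩
    fromℕ m * (b * sum x) - sum x * (fromℕ m * b)
      ≈⟨ solve 3 (λ M b s → M :* (b :* s) :- s :* (M :* b) := con (+ 0)) refl (fromℕ m) b (sum x) ⟩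
    0# ∎

  dispersion-translate : ∀ {m} b (x : Vector Carrier m) → dispersion (λ k → b + x k) ≈ dispersion x
  dispersion-translate {m} b x = begin
    dispersion (λ k → b + x k)           ≈⟨ dispersion-cong (λ k → +-comm b (x k)) ⟩
    dispersion (x +ᵛ (λ _ → b))          ≈⟨ dispersion-+ x (λ _ → b) ⟩
    dispersion x + (dispersion {m} (λ _ → b) + fromℕ 2 * covariance x (λ _ → b))
      ≈⟨ +-congˡ (+-cong (covariance-constʳ {m} (λ _ → b) b) (*-congˡ (covariance-constʳ x b))) ⟩
    dispersion x + (0# + fromℕ 2 * 0#)   ≈⟨ solve 1
      (λ a → a :+ (con (+ 0) :+ con (+ 2) :* con (+ 0)) := a) refl (dispersion x) ⟩
    dispersion x ∎

  dispersion-permute : ∀ {m} (x : Vector Carrier m) (π : Permutation′ m) →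
    dispersion (x ∘ (π ⟨$⟩ʳ_)) ≈ dispersion x
  dispersion-permute x π = sym (+-cong (*-congˡ (sum-permute (λ k → x k * x k) π))
    (-‿cong (*-cong (sum-permute x π) (sum-permute x π))))

  -- Centred, and scaled by m so as not to divide. Pairing with it turns the covariance into a plain
  -- scalar product, the shape that Abel summation needs.
  deviation : ∀ {m} → Vector Carrier m → Vector Carrier m
  deviation {m} x k = fromℕ m * x k - sum x

  sum-deviation : ∀ {m} (x y : Vector Carrier m) → x · deviation y ≈ covariance x y
  sum-deviation {m} x y = begin
    sum (λ k → x k * deviation y k)
      ≈⟨ sum-cong-≋ (λ k → solve 4 (λ x M y s → x :* (M :* y :- s)
         := M :* (x :* y) :- s :* x) refl (x k) (fromℕ m) (y k) (sum y)) ⟩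
    sum (λ k → fromℕ m * (x k * y k) - sum y * x k)
      ≈⟨ sum-- (λ k → fromℕ m * (x k * y k)) (λ k → sum y * x k) ⟩
    sum (λ k → fromℕ m * (x k * y k)) - sum (λ k → sum y * x k)
      ≈⟨ +-cong (*-distribˡ-sum (fromℕ m) (λ k → x k * y k))
         (-‿cong (trans (*-comm (sum x) (sum y)) (*-distribˡ-sum (sum y) x))) ⟨
    covariance x y ∎

  covariance-deviation : ∀ {m} (x y : Vector Carrier m) → covariance (deviation x) y
    ≈ fromℕ m * covariance x y
  covariance-deviation {m} x y = begin
    covariance (deviation x) y
      ≈⟨ covariance-cong (λ k → +-comm (fromℕ m * x k) (- sum x)) (λ _ → refl) ⟩
    covariance ((λ _ → - sum x) +ᵛ (fromℕ m *ᵛ x)) y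
      ≈⟨ covariance-+ˡ (λ _ → - sum x) (fromℕ m *ᵛ x) y ⟩
    covariance {m} (λ _ → - sum x) y + covariance (fromℕ m *ᵛ x) y
      ≈⟨ +-cong (trans (covariance-comm (λ _ → - sum x) y) (covariance-constʳ y (- sum x)))
         (covariance-*ˡ x y (fromℕ m)) ⟩
    0# + fromℕ m * covariance x y
      ≈⟨ +-identityˡ _ ⟩
    fromℕ m * covariance x y ∎

  index : ∀ {m} → Vector Carrier m
  index k = fromℕ (toℕ k)

  private
    sum-suc : ∀ {m} (x : Vector Carrier m) → sum (λ k → 1# + x k) ≈ fromℕ m + sum x
    sum-suc {m} x = trans (∑-distrib-+ (λ _ → 1#) x)
      (+-congʳ (trans (sum-const m 1#) (*-identityʳ _)))

    suc-· : ∀ {m} (x y : Vector Carrier m) → (λ k → 1# + x k) · y ≈ sum y + x · y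
    suc-· x y = trans (sum-cong-≋ (λ k → solve 2 (λ x y → (con (+ 1) :+ x) :* y
      := y :+ x :* y) refl (x k) (y k)))
      (∑-distrib-+ y (λ k → x k * y k))

    suc-·-suc : ∀ {m} (x : Vector Carrier m) → (λ k → 1# + x k) · (λ k → 1# + x k)
      ≈ fromℕ m + fromℕ 2 * sum x + x · x
    suc-·-suc {m} x = trans (suc-· x (λ k → 1# + x k))
      (trans (+-cong (sum-suc x) (trans (·-comm x (λ k → 1# + x k)) (suc-· x x)))
      (solve 3 (λ M a b → M :+ a :+ (a :+ b) := M :+ con (+ 2) :* a :+ b) refl (fromℕ m) (sum x)
        (x · x)))

  sum-index : ∀ m → fromℕ 2 * sum (index {m}) ≈ fromℕ m * (fromℕ m - 1#)
  sum-index zero    = solve 0 (con (+ 2) :* con (+ 0) := con (+ 0) :* (con (+ 0) :- con (+ 1))) refl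
  sum-index (suc m) = trans (*-congˡ (+-congˡ (sum-suc (index {m}))))
    (trans (solve 2 (λ M s → con (+ 2) :* (con (+ 0) :+ (M :+ s))
      := con (+ 2) :* s :+ con (+ 2) :* M) refl (fromℕ m) (sum (index {m})))
    (trans (+-congʳ (sum-index m))
    (solve 1 (λ M → M :* (M :- con (+ 1)) :+ con (+ 2) :* M
      := (con (+ 1) :+ M) :* (con (+ 1) :+ M :- con (+ 1))) refl (fromℕ m))))

  sum-index² : ∀ m → fromℕ 6 * (index {m} · index)
    ≈ fromℕ m * (fromℕ m - 1#) * (fromℕ 2 * fromℕ m - 1#)
  sum-index² zero    = solve 0 (con (+ 6) :* con (+ 0)
    := con (+ 0) :* (con (+ 0) :- con (+ 1)) :* (con (+ 2) :* con (+ 0) :- con (+ 1))) refl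
  sum-index² (suc m) = trans (*-congˡ (+-congˡ (suc-·-suc (index {m}))))
    (trans (solve 3 (λ M s t → con (+ 6) :* (con (+ 0) :* con (+ 0) :+ (M :+ con (+ 2) :* s :+ t))
      := con (+ 6) :* M :+ con (+ 6) :* (con (+ 2) :* s) :+ con (+ 6) :* t) refl (fromℕ m)
        (sum (index {m})) (index {m} · index))
    (trans (+-cong (+-congˡ (*-congˡ (sum-index m))) (sum-index² m))
    (solve 1 (λ M → con (+ 6) :* M :+ con (+ 6) :* (M :* (M :- con (+ 1))) :+ M :* (M :- con (+ 1))
      :* (con (+ 2) :* M :- con (+ 1))
      := (con (+ 1) :+ M) :* (con (+ 1) :+ M :- con (+ 1)) :*
        (con (+ 2) :* (con (+ 1) :+ M) :- con (+ 1))) refl (fromℕ m))))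

  -- The origin of the constant 12: the sum of the squares k² has denominator 6, the square of the
  -- sum of the k has denominator 4, and 12 clears both.
  dispersion-index : ∀ m → fromℕ 12 * dispersion (index {m})
    ≈ fromℕ m * fromℕ m * (fromℕ m * fromℕ m - 1#)
  dispersion-index m = begin
    fromℕ 12 * (M * S₂ - S₁ * S₁)
      ≈⟨ solve 3 (λ M a b → con (+ 12) :* (M :* a :- b :* b)
         := con (+ 2) :* M :* (con (+ 6) :* a) :- con (+ 3) :* (con (+ 2) :* b) :* (con (+ 2) :* b))
         refl M S₂ S₁ ⟩
    fromℕ 2 * M * (fromℕ 6 * S₂) - fromℕ 3 * (fromℕ 2 * S₁) * (fromℕ 2 * S₁)
      ≈⟨ +-cong (*-congˡ (sum-index² m)) (-‿cong (*-cong (*-congˡ (sum-index m)) (sum-index m))) ⟩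
    fromℕ 2 * M * (M * (M - 1#) * (fromℕ 2 * M - 1#)) - fromℕ 3 * (M * (M - 1#)) * (M * (M - 1#))
      ≈⟨ solve 1 (λ M → con (+ 2) :* M :* (M :* (M :- con (+ 1)) :* (con (+ 2) :* M :- con (+ 1)))
         :- con (+ 3) :* (M :* (M :- con (+ 1))) :* (M :* (M :- con (+ 1)))
          := M :* M :* (M :* M :- con (+ 1))) refl M ⟩
    M * M * (M * M - 1#) ∎
    where
    M = fromℕ m
    S₁ = sum (index {m})
    S₂ = index {m} · index

  private
    sum-d²+d : ∀ {m} a (z : Vector Carrier m) →
               sum (λ k → (z k - a) * (z k - a) + (z k - a))
                 ≈ z · z - (a + a) * sum z + fromℕ m * (a * a) + sum z - fromℕ m * a
    sum-d²+d {zero} a z = solve 1 (λ a → con (+ 0)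
      := con (+ 0) :- (a :+ a) :* con (+ 0) :+ con (+ 0) :* (a :* a) :+ con (+ 0) :- con (+ 0) :* a)
      refl a
    sum-d²+d {suc m} a z = trans (+-congˡ (sum-d²+d a (z ∘ suc)))
      (solve 5 (λ a z₀ t s M → ((z₀ :- a) :* (z₀ :- a) :+ (z₀ :- a)) :+
        (t :- (a :+ a) :* s :+ M :* (a :* a) :+ s :- M :* a)
        := (z₀ :* z₀ :+ t) :- (a :+ a) :* (z₀ :+ s) :+ (con (+ 1) :+ M) :* (a :* a) :+ (z₀ :+ s) :-
          (con (+ 1) :+ M) :* a) refl
        a (z zero) ((z ∘ suc) · (z ∘ suc)) (sum (z ∘ suc)) (fromℕ m))

    -- dispersion (index / m + z) - dispersion (index / m)
    increment : ∀ {m} → Vector Carrier m → Carrier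
    increment {m} z = fromℕ m * z · z + fromℕ 2 * (index · z) - (fromℕ m - 1#) * sum z - sum z
      * sum z

    -- Prepending an entry adds exactly the pairs that contain it. In the sum over all pairs the
    -- linear coefficient of entry k is the number of earlier entries minus the number of later
    -- ones, 2k - (m - 1), as in `increment`.
    increment-suc : ∀ {m} (z : Vector Carrier (suc m)) → let z₀ = z zero in
      increment (z ∘ suc) + sum (λ k → (z (suc k) - z₀) * (z (suc k) - z₀) + (z (suc k) - z₀))
        ≈ increment z
    increment-suc {m} z = trans (+-congˡ (sum-d²+d (z zero) (z ∘ suc)))
      (trans (solve 5 (λ M a t p s → M :* t :+ con (+ 2) :* p :- (M :- con (+ 1)) :* s :- s :* s :+
        (t :- (a :+ a) :* s :+ M :* (a :* a) :+ s :- M :* a)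
        := (con (+ 1) :+ M) :* (a :* a :+ t) :+ con (+ 2) :* (con (+ 0) :* a :+ (s :+ p)) :-
          (con (+ 1) :+ M :- con (+ 1)) :* (a :+ s) :- (a :+ s) :* (a :+ s)) refl
        (fromℕ m) (z zero) ((z ∘ suc) · (z ∘ suc)) (index · (z ∘ suc)) (sum (z ∘ suc)))
      (+-congʳ (+-congʳ (+-congˡ (*-congˡ (+-congˡ (sym (suc-· (index {m}) (z ∘ suc)))))))))

    -- Each pair of indices contributes d² + d ≥ 0, where d is the difference of
    -- its two entries.
    0≤increment : ∀ {m} {z : Vector Carrier m} → (∀ k → IsInteger (z k)) → 0# ≤ increment z
    0≤increment {zero}  iz = ≤-reflexive (solve 0 (con (+ 0)
      := con (+ 0) :* con (+ 0) :+ con (+ 2) :* con (+ 0)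
      :- (con (+ 0) :- con (+ 1)) :* con (+ 0) :- con (+ 0) :* con (+ 0)) refl)
    0≤increment {suc m} {z} iz = ≤-respʳ (increment-suc z) (0≤-+ (0≤increment (iz ∘ suc))
      (0≤sum (λ k → isInteger⇒0≤x²+x (isInteger-- (iz (suc k)) (iz zero)))))

    increment-covariance : ∀ {m} (z : Vector Carrier m) →
      fromℕ m * increment z ≈ fromℕ m * dispersion z + fromℕ 2 * covariance index z
    increment-covariance {m} z = trans
      (solve 4 (λ M t p s → M :* (M :* t :+ con (+ 2) :* p :- (M :- con (+ 1)) :* s :- s :* s)
        := M :* (M :* t :- s :* s) :+ con (+ 2) :* (M :* p) :- M :* (M :- con (+ 1)) :* s) refl
          (fromℕ m) (z · z) (index · z) (sum z))
      (trans (+-congˡ (-‿cong (*-congʳ (sym (sum-index m)))))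
      (solve 5 (λ M t p s i → M :* (M :* t :- s :* s) :+ con (+ 2) :* (M :* p) :- con (+ 2) :* i :*
        s
        := M :* (M :* t :- s :* s) :+ con (+ 2) :* (M :* p :- i :* s)) refl (fromℕ m) (z · z)
          (index · z) (sum z) (sum (index {m}))))

  0≤dispersion+covariance-index : ∀ {m} {z : Vector Carrier m} → (∀ k → IsInteger (z k)) →
    0# ≤ fromℕ m * dispersion z + fromℕ 2 * covariance index z
  0≤dispersion+covariance-index {m} {z} iz = ≤-respʳ (increment-covariance z)
    (0≤-* (0≤fromℕ m) (0≤increment iz))

-- Extremal dispersion modulo integer vectors

module Extremal {c ℓ₁ ℓ₂ : Level} (R : Reals c ℓ₁ ℓ₂) where
  open Reals R hiding (zero)
  open OrderedField R
  open Euclidean R using (_+ᵛ_; _-ᵛ_; _*ᵛ_; _≈ᵛ_)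
  open Integers R
  open Sums R
  open Dispersion R
  open SetoidReasoning setoid

  equidistributed-dispersion-index : ∀ m → fromℕ 12 * dispersion (⅟ suc m *ᵛ index {suc m})
    ≈ fromℕ (suc m) * fromℕ (suc m) - 1#
  equidistributed-dispersion-index m = begin
    fromℕ 12 * dispersion (i *ᵛ index {suc m})
      ≈⟨ *-congˡ (dispersion-* i (index {suc m})) ⟩
    fromℕ 12 * (i * i * dispersion (index {suc m}))
      ≈⟨ solve 2 (λ i w → con (+ 12) :* (i :* i :* w)
         := i :* i :* (con (+ 12) :* w)) refl i (dispersion (index {suc m})) ⟩
    i * i * (fromℕ 12 * dispersion (index {suc m}))
      ≈⟨ *-congˡ (dispersion-index (suc m)) ⟩
    i * i * (M * M * (M * M - 1#))
      ≈⟨ solve 3 (λ i M x → i :* i :* (M :* M :* x)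
         := i :* M :* (i :* M) :* x) refl i M (M * M - 1#) ⟩
    i * M * (i * M) * (M * M - 1#)
      ≈⟨ *-congʳ (*-cong (⅟-inverse (suc m)) (⅟-inverse (suc m))) ⟩
    1# * 1# * (M * M - 1#)
      ≈⟨ solve 1 (λ x → con (+ 1) :* con (+ 1) :* x := x) refl (M * M - 1#) ⟩
    M * M - 1# ∎
    where
    i = ⅟ suc m
    M = fromℕ (suc m)

  dispersion-≥ : ∀ {m} {z : Vector Carrier (suc m)} → (∀ k → IsInteger (z k)) →
                 fromℕ (suc m) * fromℕ (suc m) - 1# ≤ fromℕ 12 * dispersion (⅟ suc m *ᵛ index +ᵛ z)
  dispersion-≥ {m} {z} iz = ≤-respˡ (equidistributed-dispersion-index m)
    (*-monoˡ-≤ (0≤fromℕ 12) (0≤-⇒≤ (≤-respʳ eq 0≤increment)))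
    where
    i = ⅟ suc m
    M = fromℕ (suc m)
    0≤increment : 0# ≤ dispersion z + fromℕ 2 * (i * covariance index z)
    0≤increment = *-cancelˡ-0≤ (0<fromℕ m) (≤-respʳ (begin
      M * dispersion z + fromℕ 2 * covariance index z
        ≈⟨ +-congˡ (trans (*-congʳ (⅟-inverse (suc m))) (*-identityˡ _)) ⟨
      M * dispersion z + i * M * (fromℕ 2 * covariance index z)
        ≈⟨ solve 4 (λ M i w v → M :* w :+ i :* M :* (con (+ 2) :* v)
           := M :* (w :+ con (+ 2) :* (i :* v))) refl M i (dispersion z) (covariance index z) ⟩
      M * (dispersion z + fromℕ 2 * (i * covariance index z)) ∎)
      (0≤dispersion+covariance-index iz))
    eq : dispersion z + fromℕ 2 * (i * covariance index z)
      ≈ dispersion (i *ᵛ index +ᵛ z) - dispersion (i *ᵛ index {suc m})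
    eq = begin
      dispersion z + fromℕ 2 * (i * covariance index z)
        ≈⟨ +-congˡ (*-congˡ (covariance-*ˡ index z i)) ⟨
      dispersion z + fromℕ 2 * covariance (i *ᵛ index) z
        ≈⟨ solve 2 (λ a b → b := a :+ b :- a) refl (dispersion (i *ᵛ index {suc m})) _ ⟩
      dispersion (i *ᵛ index {suc m}) + (dispersion z + fromℕ 2 * covariance (i *ᵛ index) z)
        - dispersion (i *ᵛ index {suc m})
        ≈⟨ +-congʳ (dispersion-+ (i *ᵛ index) z) ⟨
      dispersion (i *ᵛ index +ᵛ z) - dispersion (i *ᵛ index {suc m}) ∎

  suffix : ∀ {m} → Fin m → Vector Carrier m
  suffix zero    _       = 1#
  suffix (suc p) zero    = 0#
  suffix (suc p) (suc k) = suffix p k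

  isInteger-suffix : ∀ {m} (p k : Fin m) → IsInteger (suffix p k)
  isInteger-suffix zero    _       = isInteger-resp (+-identityʳ 1#) (isInteger-fromℕ 1)
  isInteger-suffix (suc p) zero    = isInteger-fromℕ 0
  isInteger-suffix (suc p) (suc k) = isInteger-suffix p k

  -- A 0-1 vector is its own entrywise square, so a suffix with q ones has dispersion q (m - q).
  dispersion-suffix : ∀ {m} (p : Fin m) → dispersion (suffix p)
    ≈ fromℕ m * sum (suffix p) - sum (suffix p) * sum (suffix p)
  dispersion-suffix p = +-congʳ (*-congˡ (sum-cong-≋ (idempotent p)))
    where
    idempotent : ∀ {m} (p k : Fin m) → suffix p k * suffix p k ≈ suffix p k
    idempotent zero    _       = *-identityˡ 1#
    idempotent (suc p) zero    = zeroˡ 0#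
    idempotent (suc p) (suc k) = idempotent p k

  -- A suffix with q ones selects the indices m - q, ..., m - 1, and twice their sum is q (2m - q -
  -- 1).
  sum-suffix-index : ∀ {m} (p : Fin m) → let q = sum (suffix p) in
                     fromℕ 2 * sum (λ k → suffix p k * index k)
                       ≈ fromℕ 2 * (fromℕ m * q) - q * q - q
  sum-suffix-index {m} zero = begin
    fromℕ 2 * sum (λ k → 1# * index {m} k)
      ≈⟨ *-congˡ (sum-cong-≋ (λ k → *-identityˡ (index {m} k))) ⟩
    fromℕ 2 * sum (index {m})                 ≈⟨ sum-index m ⟩
    M * (M - 1#)                              ≈⟨ solve 1 (λ M → M :* (M :- con (+ 1))
      := con (+ 2) :* (M :* M) :- M :* M :- M) refl M ⟩
    fromℕ 2 * (M * M) - M * M - M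
      ≈⟨ +-cong (+-cong (*-congˡ (*-congˡ q≈M)) (-‿cong (*-cong q≈M q≈M))) (-‿cong q≈M) ⟨
    fromℕ 2 * (M * q) - q * q - q             ∎
    where
    M = fromℕ m
    q = sum {m} (λ _ → 1#)
    q≈M : q ≈ M
    q≈M = trans (sum-const m 1#) (*-identityʳ M)
  sum-suffix-index {suc m} (suc p) = begin
    fromℕ 2 * (0# * 0# + sum (λ k → suffix p k * (1# + index k)))
      ≈⟨ *-congˡ (+-congˡ (trans (sum-cong-≋ (λ k →
         trans (distribˡ (suffix p k) 1# (index k)) (+-congʳ (*-identityʳ _))))
         (∑-distrib-+ (suffix p) (λ k → suffix p k * index k)))) ⟩
    fromℕ 2 * (0# * 0# + (q + sum (λ k → suffix p k * index k)))
      ≈⟨ solve 2 (λ q s → con (+ 2) :* (con (+ 0) :* con (+ 0) :+ (q :+ s))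
         := con (+ 2) :* q :+ con (+ 2) :* s) refl q _ ⟩
    fromℕ 2 * q + fromℕ 2 * sum (λ k → suffix p k * index k)
      ≈⟨ +-congˡ (sum-suffix-index p) ⟩
    fromℕ 2 * q + (fromℕ 2 * (fromℕ m * q) - q * q - q)
      ≈⟨ solve 2 (λ q M → con (+ 2) :* q :+ (con (+ 2) :* (M :* q) :- q :* q :- q)
         := con (+ 2) :* ((con (+ 1) :+ M) :* (con (+ 0) :+ q)) :- (con (+ 0) :+ q) :*
           (con (+ 0) :+ q) :- (con (+ 0) :+ q)) refl q (fromℕ m) ⟩
    fromℕ 2 * (fromℕ (suc m) * (0# + q)) - (0# + q) * (0# + q) - (0# + q) ∎
    where q = sum (suffix p)

  -- For x = k/m this says that lowering a suffix by 1 leaves the dispersion unchanged. The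
  -- arithmetic progression thus turns into equalities all the inequalities that minimality imposes
  -- through suffixes, which is why it is the extreme case.
  covariance-suffix-index : ∀ {m} (p : Fin m) → fromℕ 2 * covariance (suffix p) index
    ≈ fromℕ m * dispersion (suffix p)
  covariance-suffix-index {m} p = begin
    fromℕ 2 * (M * t - q * sum (index {m}))
      ≈⟨ solve 4 (λ M t q s → con (+ 2) :* (M :* t :- q :* s)
         := M :* (con (+ 2) :* t) :- q :* (con (+ 2) :* s)) refl M t q (sum (index {m})) ⟩
    M * (fromℕ 2 * t) - q * (fromℕ 2 * sum (index {m}))
      ≈⟨ +-cong (*-congˡ (sum-suffix-index p)) (-‿cong (*-congˡ (sum-index m))) ⟩
    M * (fromℕ 2 * (M * q) - q * q - q) - q * (M * (M - 1#))
      ≈⟨ solve 2 (λ M q → M :* (con (+ 2) :* (M :* q) :- q :* q :- q) :- q :*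
         (M :* (M :- con (+ 1))) := M :* (M :* q :- q :* q)) refl M q ⟩
    M * (M * q - q * q)
      ≈⟨ *-congˡ (dispersion-suffix p) ⟨
    M * dispersion (suffix p) ∎
    where
    M = fromℕ m
    q = sum (suffix p)
    t = sum (λ k → suffix p k * index k)

  fromℕ-mono-≤ : ∀ {m n} → m ℕ.≤ n → fromℕ m ≤ fromℕ n
  fromℕ-mono-≤ {n = n} z≤n = 0≤fromℕ n
  fromℕ-mono-≤ (s≤s m≤n)   = +-mono-≤ (≤-reflexive refl) (fromℕ-mono-≤ m≤n)

  Ascending : ∀ {m} → Pred (Vector Carrier m) ℓ₂
  Ascending x = ∀ {k l} → k Fin.≤ l → x k ≤ x l

  -- The sum of the entries of `r` still to come is nonnegative, so replacing its factor `s zero` by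
  -- the larger `s (suc zero)` only increases the product; the induction does this at every
  -- position.
  abelSummation : ∀ {m} (r s : Vector Carrier (suc m)) → Ascending s →
                  (∀ p → 0# ≤ sum (λ k → suffix p k * r k)) → s zero * sum r ≤ sum (λ k → r k * s k)
  abelSummation {zero} r s _ _ = ≤-reflexive (solve 2 (λ r s → s :* (r :+ con (+ 0))
    := r :* s :+ con (+ 0)) refl (r zero) (s zero))
  abelSummation {suc m} r s asc 0≤suffix = ≤-respˡ (solve 3 (λ r s t → r :* s :+ t :* s
    := s :* (r :+ t)) refl (r zero) (s zero) t)
    (+-mono-≤ (≤-reflexive refl) (≤-trans
      (≤-respʳ (*-comm t (s (suc zero))) s₀t≤s₁t)
      (abelSummation (r ∘ suc) (s ∘ suc) (λ k≤l → asc (s≤s k≤l)) 0≤suffix-tail)))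
    where
    t = sum (r ∘ suc)
    0≤suffix-tail : ∀ p → 0# ≤ sum (λ k → suffix p k * r (suc k))
    0≤suffix-tail p = ≤-respʳ (solve 2 (λ r s → con (+ 0) :* r :+ s
      := s) refl (r zero) _) (0≤suffix (suc p))
    0≤t : 0# ≤ t
    0≤t = ≤-respʳ (sum-cong-≋ (λ k → *-identityˡ (r (suc k)))) (0≤suffix-tail zero)
    s₀t≤s₁t : t * s zero ≤ t * s (suc zero)
    s₀t≤s₁t = *-monoˡ-≤ 0≤t (asc z≤n)

  private
    minimum-¬¬ : ∀ {m} (x : Vector Carrier (suc m)) → ¬ ¬ (∃[ i ] ∀ k → x i ≤ x k)
    minimum-¬¬ {zero}  x none = none (zero , λ where zero → ≤-reflexive refl)
    minimum-¬¬ {suc m} x none = minimum-¬¬ (x ∘ suc) λ (i , min) →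
      ≤-total-¬¬ (x zero) (x (suc i)) λ where
      (inj₁ x₀≤) → none (zero , λ where
        zero    → ≤-reflexive refl
        (suc k) → ≤-trans x₀≤ (min k))
      (inj₂ ≤x₀) → none (suc i , λ where
        zero    → ≤x₀
        (suc k) → min k)

  -- The order of the reals is not decidable, so the sorting permutation exists
  -- only up to double negation.
  sort-¬¬ : ∀ {m} (x : Vector Carrier m) → ¬ ¬ (Σ[ π ∈ Permutation′ m ] Ascending (x ∘ (π ⟨$⟩ʳ_)))
  sort-¬¬ {zero}  x none = none (Perm.id , λ {k} → contradiction k Fin.¬Fin0)
  sort-¬¬ {suc m} x none = minimum-¬¬ x λ (i , min) → sort-¬¬ (removeAt x i) λ (π , asc) →
    none (Perm.insert zero i π , insert-ascending i π min asc)
    where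
    insert-ascending : ∀ i (π : Permutation′ m) → (∀ k → x i ≤ x k) →
      Ascending (removeAt x i ∘ (π ⟨$⟩ʳ_)) →
                       Ascending (x ∘ (Perm.insert zero i π ⟨$⟩ʳ_))
    insert-ascending i π min asc {zero}  {zero}  _         = ≤-reflexive refl
    insert-ascending i π min asc {zero}  {suc l} _         = min _
    insert-ascending i π min asc {suc k} {suc l} (s≤s k≤l) = asc k≤l

  IsLatticeMinimal : ∀ {m} → Pred (Vector Carrier m) (c ⊔ ℓ₁ ⊔ ℓ₂)
  IsLatticeMinimal x = ∀ z → (∀ k → IsInteger (z k)) → dispersion x ≤ dispersion (x +ᵛ z)

  IsLatticeMinimal-permute : ∀ {m} {x : Vector Carrier m} (π : Permutation′ m) →
                             IsLatticeMinimal x → IsLatticeMinimal (x ∘ (π ⟨$⟩ʳ_))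
  IsLatticeMinimal-permute {m} {x} π minimal z iz = ≤-respˡ (sym (dispersion-permute x π))
    (≤-respʳ eq (minimal (z ∘ (π ⟨$⟩ˡ_)) (iz ∘ (π ⟨$⟩ˡ_))))
    where
    eq : dispersion (x +ᵛ z ∘ (π ⟨$⟩ˡ_)) ≈ dispersion (x ∘ (π ⟨$⟩ʳ_) +ᵛ z)
    eq = trans (sym (dispersion-permute (x +ᵛ z ∘ (π ⟨$⟩ˡ_)) π))
      (dispersion-cong {m} (λ k → +-congˡ {x (π ⟨$⟩ʳ k)} (reflexive (≡.cong z (Perm.inverseˡ π)))))

  -- A minimal ascending x cannot be improved by lowering a suffix by 1, which
  -- bounds all its suffix sums by those of the arithmetic progression.
  dispersion-≤-ascending : ∀ {m} {x : Vector Carrier (suc m)} → Ascending x → IsLatticeMinimal x →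
                           fromℕ 12 * dispersion x ≤ fromℕ (suc m) * fromℕ (suc m) - 1#
  dispersion-≤-ascending {m} {x} asc minimal = 0≤-⇒≤ (*-cancelˡ-0≤ (*-pos (0<fromℕ m) (0<fromℕ m))
    (≤-respʳ rescale (0≤-* (0≤fromℕ 12) (*-cancelˡ-0≤ (0<fromℕ m) 0≤abel))))
    where
    M = fromℕ (suc m)
    -- A difference of squares: by bilinearity `covariance d e` is the dispersion of `index` minus
    -- M² times that of `x`, so the claim becomes its nonnegativity. Minimality of `x` controls the
    -- suffixes of `d`, while `e` is ascending along with `x`.
    d = index +ᵛ (- M) *ᵛ x
    e = index +ᵛ M *ᵛ x

    0≤suffix-d : ∀ p → 0# ≤ covariance (suffix p) d
    0≤suffix-d p = *-cancelˡ-0≤ (0<fromℕ 1) (≤-respʳ (begin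
      M * (W - fromℕ 2 * C)
        ≈⟨ solve 3 (λ M w v → M :* (w :- con (+ 2) :* v)
           := M :* w :+ con (+ 2) :* (:- M :* v)) refl M W C ⟩
      M * W + fromℕ 2 * (- M * C)
        ≈⟨ +-cong (covariance-suffix-index p) (*-congˡ (covariance-*ʳ (suffix p) x (- M))) ⟨
      fromℕ 2 * covariance (suffix p) index + fromℕ 2 * covariance (suffix p) ((- M) *ᵛ x)
        ≈⟨ distribˡ _ _ _ ⟨
      fromℕ 2 * (covariance (suffix p) index + covariance (suffix p) ((- M) *ᵛ x))
        ≈⟨ *-congˡ (covariance-+ʳ (suffix p) index ((- M) *ᵛ x)) ⟨
      fromℕ 2 * covariance (suffix p) d ∎)
      (0≤-* (0≤fromℕ (suc m)) (≤-respʳ lowering (≤⇒0≤- (minimal ((- 1#) *ᵛ suffix p) λ k →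
        isInteger-resp (solve 1 (λ a → :- a := :- con (+ 1) :* a) refl (suffix p k))
          (isInteger-neg (isInteger-suffix p k)))))))
      where
      W = dispersion (suffix p)
      C = covariance (suffix p) x
      lowering : dispersion (x +ᵛ (- 1#) *ᵛ suffix p) - dispersion x ≈ W - fromℕ 2 * C
      lowering = begin
        dispersion (x +ᵛ (- 1#) *ᵛ suffix p) - dispersion x
          ≈⟨ +-congʳ (dispersion-+ x ((- 1#) *ᵛ suffix p)) ⟩
        dispersion x + (dispersion ((- 1#) *ᵛ suffix p) + fromℕ 2
          * covariance x ((- 1#) *ᵛ suffix p)) - dispersion x
          ≈⟨ +-congʳ (+-congˡ (+-cong (dispersion-* (- 1#) (suffix p))
             (*-congˡ (trans (covariance-*ʳ x (suffix p) (- 1#))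
             (*-congˡ (covariance-comm x (suffix p))))))) ⟩
        dispersion x + ((- 1#) * (- 1#) * W + fromℕ 2 * (- 1# * C)) - dispersion x
          ≈⟨ solve 3 (λ a w v → a :+ ((:- con (+ 1)) :* (:- con (+ 1)) :* w :+ con (+ 2) :*
             (:- con (+ 1) :* v)) :- a := w :- con (+ 2) :* v) refl (dispersion x) W C ⟩
        W - fromℕ 2 * C ∎

    ascending-e : Ascending (deviation e)
    ascending-e {k} {l} k≤l = +-mono-≤ (*-monoˡ-≤ (0≤fromℕ (suc m))
      (+-mono-≤ index-mono (*-monoˡ-≤ (0≤fromℕ (suc m)) (asc k≤l)))) (≤-reflexive refl)
      where
      index-mono : index k ≤ index l
      index-mono = fromℕ-mono-≤ k≤l

    sum-deviation-d : sum (deviation d) ≈ 0#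
    sum-deviation-d = begin
      sum (deviation d)                         ≈⟨ sum-cong-≋ (λ k → *-identityˡ (deviation d k)) ⟨
      sum (λ k → 1# * deviation d k)            ≈⟨ sum-deviation (λ _ → 1#) d ⟩
      covariance {suc m} (λ _ → 1#) d           ≈⟨ covariance-comm (λ _ → 1#) d ⟩
      covariance d (λ _ → 1#)                   ≈⟨ covariance-constʳ d 1# ⟩
      0#                                        ∎

    covariance-d-e : covariance d e ≈ dispersion (index {suc m}) - M * M * dispersion x
    covariance-d-e = begin
      covariance d e
        ≈⟨ covariance-+ˡ index ((- M) *ᵛ x) e ⟩
      covariance index e + covariance ((- M) *ᵛ x) e
        ≈⟨ +-cong (covariance-+ʳ index index (M *ᵛ x))
           (trans (covariance-*ˡ x e (- M)) (*-congˡ (covariance-+ʳ x index (M *ᵛ x)))) ⟩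
      dispersion (index {suc m}) + covariance index (M *ᵛ x) + - M
        * (covariance x index + covariance x (M *ᵛ x))
        ≈⟨ +-cong (+-congˡ (covariance-*ʳ index x M))
           (*-congˡ (+-cong (covariance-comm x index) (covariance-*ʳ x x M))) ⟩
      dispersion (index {suc m}) + M * covariance index x + - M
        * (covariance index x + M * dispersion x)
        ≈⟨ solve 4 (λ a M v w → a :+ M :* v :+ :- M :* (v :+ M :* w)
           := a :- M :* M :* w) refl (dispersion (index {suc m})) M (covariance index x)
           (dispersion x) ⟩
      dispersion (index {suc m}) - M * M * dispersion x ∎

    -- Centring `d` makes its total vanish, and with it the left-hand side of Abel summation; the
    -- scalar product of the two deviations is M times the covariance.
    0≤abel : 0# ≤ M * covariance d e
    0≤abel = ≤-respʳ (trans (sum-deviation (deviation d) e) (covariance-deviation d e))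
      (≤-respˡ (trans (*-congˡ sum-deviation-d) (zeroʳ _))
        (abelSummation (deviation d) (deviation e) ascending-e
        (λ p → ≤-respʳ (sym (sum-deviation (suffix p) d)) (0≤suffix-d p))))

    rescale : fromℕ 12 * covariance d e ≈ M * M * (M * M - 1# - fromℕ 12 * dispersion x)
    rescale = begin
      fromℕ 12 * covariance d e
        ≈⟨ *-congˡ covariance-d-e ⟩
      fromℕ 12 * (dispersion (index {suc m}) - M * M * dispersion x)
        ≈⟨ distribˡ (fromℕ 12) _ _ ⟩
      fromℕ 12 * dispersion (index {suc m}) + fromℕ 12 * - (M * M * dispersion x)
        ≈⟨ +-congʳ (dispersion-index (suc m)) ⟩
      M * M * (M * M - 1#) + fromℕ 12 * - (M * M * dispersion x)
        ≈⟨ solve 3 (λ M t w → M :* M :* (M :* M :- con (+ 1)) :+ t :* :- (M :* M :* w)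
           := M :* M :* (M :* M :- con (+ 1) :- t :* w)) refl M (fromℕ 12) (dispersion x) ⟩
      M * M * (M * M - 1# - fromℕ 12 * dispersion x) ∎

  dispersion-≤ : ∀ {m} {x : Vector Carrier (suc m)} → IsLatticeMinimal x →
                 fromℕ 12 * dispersion x ≤ fromℕ (suc m) * fromℕ (suc m) - 1#
  -- The goal is a negation with `bound<W` as its argument, so the doubly negated sorting may be
  -- unwrapped.
  dispersion-≤ {x = x} minimal bound<W = sort-¬¬ x λ (π , asc) →
    dispersion-≤-ascending asc (IsLatticeMinimal-permute {x = x} π minimal)
      (<-respʳ (*-congˡ (sym (dispersion-permute x π))) bound<W)

  uniform-dispersion-≥ : ∀ {m} {y z : Vector Carrier (suc m)} → UniformModOne y →
    (∀ k → IsInteger (z k)) →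
                         fromℕ (suc m) * fromℕ (suc m) - 1# ≤ fromℕ 12 * dispersion (y +ᵛ z)
  uniform-dispersion-≥ {m} {y} {z} (b , π , near) iz = ≤-respʳ (*-congˡ (begin
    dispersion (⅟ suc m *ᵛ index +ᵛ z′)
      ≈⟨ dispersion-translate b (⅟ suc m *ᵛ index +ᵛ z′) ⟨
    dispersion (λ k → b + (⅟ suc m *ᵛ index +ᵛ z′) k)   ≈⟨ dispersion-cong recombine ⟩
    dispersion ((y +ᵛ z) ∘ (π ⟨$⟩ʳ_))                   ≈⟨ dispersion-permute (y +ᵛ z) π ⟩
    dispersion (y +ᵛ z)                                 ∎))
    (dispersion-≥ (λ k → isInteger-+ (near k) (iz (π ⟨$⟩ʳ k))))
    where
    z′ : Vector Carrier (suc m)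
    z′ k = y (π ⟨$⟩ʳ k) - (b + fromℕ (toℕ k) / suc m) + z (π ⟨$⟩ʳ k)
    recombine : (λ k → b + (⅟ suc m *ᵛ index +ᵛ z′) k) ≈ᵛ (y +ᵛ z) ∘ (π ⟨$⟩ʳ_)
    recombine k = trans (+-congˡ (+-congʳ (trans (*-comm (⅟ suc m) (index k))
      (sym (/≈*⅟ (index k) (suc m))))))
      (solve 4 (λ b f y z → b :+ (f :+ (y :- (b :+ f) :+ z)) := y :+ z) refl
        b (index k / suc m) (y (π ⟨$⟩ʳ k)) (z (π ⟨$⟩ʳ k)))

  uniform-dispersion-attained : ∀ {m} {y : Vector Carrier (suc m)} → UniformModOne y →
    ∃[ z ] ((∀ k → IsInteger (z k)) × fromℕ 12 * dispersion (y +ᵛ z)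
      ≈ fromℕ (suc m) * fromℕ (suc m) - 1#)
  uniform-dispersion-attained {m} {y} (b , π , near) = z , (λ k → isInteger-neg (near (π ⟨$⟩ˡ k))) ,
    (begin
    fromℕ 12 * dispersion (y +ᵛ z)
      ≈⟨ *-congˡ (dispersion-permute (y +ᵛ z) π) ⟨
    fromℕ 12 * dispersion ((y +ᵛ z) ∘ (π ⟨$⟩ʳ_))
      ≈⟨ *-congˡ (dispersion-cong recombine) ⟩
    fromℕ 12 * dispersion (λ k → b + (⅟ suc m *ᵛ index {suc m}) k)
      ≈⟨ *-congˡ (dispersion-translate b (⅟ suc m *ᵛ index {suc m})) ⟩
    fromℕ 12 * dispersion (⅟ suc m *ᵛ index {suc m})
      ≈⟨ equidistributed-dispersion-index m ⟩
    fromℕ (suc m) * fromℕ (suc m) - 1#                            ∎)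
    where
    -- Cancels the integer discrepancy of each coordinate. The round trip through `π` is left
    -- unsimplified so that integrality is an instance of `near` without transport.
    z : Vector Carrier (suc m)
    z k = - (y (π ⟨$⟩ʳ (π ⟨$⟩ˡ k)) - (b + fromℕ (toℕ (π ⟨$⟩ˡ k)) / suc m))
    recombine : (y +ᵛ z) ∘ (π ⟨$⟩ʳ_) ≈ᵛ λ k → b + (⅟ suc m *ᵛ index) k
    recombine k rewrite Perm.inverseˡ π {k} = trans
      (solve 2 (λ a y → y :+ :- (y :- a) := a) refl (b + fromℕ (toℕ k) / suc m) (y (π ⟨$⟩ʳ k)))
      (+-congˡ (trans (/≈*⅟ (index k) (suc m)) (*-comm (index k) (⅟ suc m))))

-- The coordinates other than two given ones

module _ {n : ℕ} {i j : Fin (suc (suc n))} (i≢j : i ≢ j) where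

  -- Chosen so that `removeTwo i≢j y k` computes to `y (other i≢j k)`.
  other : Fin n → Fin (suc (suc n))
  other k = punchIn i (punchIn (punchOut i≢j) k)

  other≢i : ∀ k → other k ≢ i
  other≢i k = Fin.punchInᵢ≢i i _

  other≢j : ∀ k → other k ≢ j
  other≢j k eq = Fin.punchInᵢ≢i (punchOut i≢j) k
    (Fin.punchIn-injective i _ _ (≡.trans eq (≡.sym (Fin.punchIn-punchOut i≢j))))

  other-injective : ∀ {k l} → other k ≡ other l → k ≡ l
  other-injective eq = Fin.punchIn-injective (punchOut i≢j) _ _ (Fin.punchIn-injective i _ _ eq)

  other-elim : ∀ {p} {P : Pred (Fin (suc (suc n))) p} → P i → P j → (∀ k → P (other k)) → ∀ l → P l
  other-elim {P = P} Pi Pj Po l with i Fin.≟ l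
  ... | yes ≡.refl = Pi
  ... | no i≢l with punchOut i≢j Fin.≟ punchOut i≢l
  ...   | yes eq = ≡.subst P (≡.trans (≡.sym (Fin.punchIn-punchOut i≢j))
                     (≡.trans (≡.cong (punchIn i) eq) (Fin.punchIn-punchOut i≢l))) Pj
  ...   | no  neq = ≡.subst P (≡.trans (≡.cong (punchIn i) (Fin.punchIn-punchOut neq))
    (Fin.punchIn-punchOut i≢l)) (Po (punchOut neq))

-- The lattices and their projections

module Lattice {c ℓ₁ ℓ₂ : Level} (R : Reals c ℓ₁ ℓ₂) where
  open Reals R hiding (zero)
  open OrderedField R
  open Euclidean R
  open Integers R
  open Sums R
  open SetoidReasoning setoid

  sum-removeTwo : ∀ {n} {i j : Fin (suc (suc n))} (i≢j : i ≢ j) (y : Vector Carrier (suc (suc n))) →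
                  sum y ≈ y i + (y j + sum (removeTwo i≢j y))
  sum-removeTwo {_} {i} i≢j y = trans (sum-remove {i = i} y)
    (+-congˡ (trans (sum-remove {i = punchOut i≢j} (removeAt y i))
    (+-congʳ (reflexive (removeAt-punchOut y i≢j)))))

  module _ (n : ℕ) where

    private
      ν = ⅟ suc n

    v-diagonal : ∀ i → v n i i ≈ 1# - ν
    v-diagonal i with i Fin.≟ i
    ... | no i≢i = contradiction ≡.refl i≢i
    ... | yes _  = begin
      fromℕ n / suc n               ≈⟨ /≈*⅟ (fromℕ n) (suc n) ⟩
      fromℕ n * ν                   ≈⟨ solve 2 (λ N ν → N :* ν
        := ν :* (con (+ 1) :+ N) :- ν) refl (fromℕ n) ν ⟩
      ν * fromℕ (suc n) - ν         ≈⟨ +-congʳ (⅟-inverse (suc n)) ⟩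
      1# - ν                        ∎

    v-off-diagonal : ∀ {i j} → i ≢ j → v n i j ≈ - ν
    v-off-diagonal {i} {j} i≢j with i Fin.≟ j
    ... | yes i≡j = contradiction i≡j i≢j
    ... | no  _   = refl

    sum-v : ∀ i → sum (v n i) ≈ 0#
    sum-v i = begin
      sum (v n i)                                ≈⟨ sum-remove {i = i} (v n i) ⟩
      v n i i + sum (removeAt (v n i) i)
        ≈⟨ +-cong (v-diagonal i) (sum-cong-≋ (λ k →
        v-off-diagonal (λ eq → Fin.punchInᵢ≢i i k (≡.sym eq)))) ⟩
      1# - ν + sum {n} (λ _ → - ν)               ≈⟨ +-congˡ (sum-const n (- ν)) ⟩
      1# - ν + fromℕ n * - ν                     ≈⟨ solve 2 (λ N ν → con (+ 1) :- ν :+ N :* :- ν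
        := con (+ 1) :- ν :* (con (+ 1) :+ N)) refl (fromℕ n) ν ⟩
      1# - ν * fromℕ (suc n)                     ≈⟨ +-congˡ (-‿cong (⅟-inverse (suc n))) ⟩
      1# - 1#                                    ≈⟨ -‿inverseʳ 1# ⟩
      0#                                         ∎

    A⊆A* : ∀ {x} → x ∈ A n → x ∈ A* n
    A⊆A* (x∈H , ix) = x∈H , λ k l → isInteger-- (ix k) (ix l)

    -- Modulo v⁽ⁱ⁾ the two lattices coincide. The multiple `s` is an integer because all differences
    -- of coordinates are, and it equals -(n + 1) xᵢ because x sums to 0. Subtracting s v⁽ⁱ⁾
    -- therefore turns xₖ into xₖ - xᵢ for k ≠ i and xᵢ into -s.
    A*-decompose : ∀ i {x} → x ∈ A* n → ∃[ a ] (a ∈ A n × ∃[ s ] (x ≈ᵛ a +ᵛ s *ᵛ v n i))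
    A*-decompose i {x} (x∈H , ix) = a , (a∈H , ia) , s , λ k → solve 2 (λ x y → x
      := (x :- y) :+ y) refl (x k) (s * v n i k)
      where
      s = sum (λ k → x k - x i)
      a : Vector Carrier (suc n)
      a k = x k - s * v n i k

      s≈-Nxᵢ : s ≈ - (fromℕ (suc n) * x i)
      s≈-Nxᵢ = begin
        s                                      ≈⟨ sum-- x (λ _ → x i) ⟩
        sum x - sum {suc n} (λ _ → x i)        ≈⟨ +-cong x∈H (-‿cong (sum-const (suc n) (x i))) ⟩
        0# - fromℕ (suc n) * x i               ≈⟨ +-identityˡ _ ⟩
        - (fromℕ (suc n) * x i)                ∎

      sν≈-xᵢ : s * ν ≈ - x i
      sν≈-xᵢ = begin
        s * ν                            ≈⟨ *-congʳ s≈-Nxᵢ ⟩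
        - (fromℕ (suc n) * x i) * ν      ≈⟨ solve 3 (λ N x ν → :- (N :* x) :* ν
          := :- (ν :* N :* x)) refl (fromℕ (suc n)) (x i) ν ⟩
        - (ν * fromℕ (suc n) * x i)      ≈⟨ -‿cong
          (trans (*-congʳ (⅟-inverse (suc n))) (*-identityˡ (x i))) ⟩
        - x i                            ∎

      a∈H : a ∈ H n
      a∈H = begin
        sum a                                            ≈⟨ sum-- x (λ k → s * v n i k) ⟩
        sum x - sum (λ k → s * v n i k)
          ≈⟨ +-cong x∈H (-‿cong (sym (*-distribˡ-sum s (v n i)))) ⟩
        0# - s * sum (v n i)                             ≈⟨ +-congˡ (-‿cong (*-congˡ (sum-v i))) ⟩
        0# - s * 0#
          ≈⟨ solve 1 (λ s → con (+ 0) :- s :* con (+ 0) := con (+ 0)) refl s ⟩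
        0#                                               ∎

      ia : ∀ k → IsInteger (a k)
      ia k = case i Fin.≟ k of λ where
        (yes ≡.refl) → isInteger-resp (begin
          - s                        ≈⟨ solve 2 (λ s x → :- s := x :- s :- x) refl s (x i) ⟩
          x i - s - x i              ≈⟨ +-congˡ sν≈-xᵢ ⟨
          x i - s + s * ν            ≈⟨ solve 3 (λ x s ν → x :- s :+ s :* ν
            := x :- s :* (con (+ 1) :- ν)) refl (x i) s ν ⟩
          x i - s * (1# - ν)         ≈⟨ +-congˡ (-‿cong (*-congˡ (v-diagonal i))) ⟨
          a i                        ∎)
          (isInteger-neg (isInteger-sum (λ k → ix k i)))
        (no i≢k) → isInteger-resp (begin
          x k - x i                  ≈⟨ +-congˡ sν≈-xᵢ ⟨
          x k + s * ν                ≈⟨ solve 3 (λ x s ν → x :+ s :* ν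
            := x :- s :* (:- ν)) refl (x k) s ν ⟩
          x k - s * - ν              ≈⟨ +-congˡ (-‿cong (*-congˡ (v-off-diagonal i≢k))) ⟨
          a k                        ∎)
          (ix k i)

    -- The translation vector is `w` itself, since it already lies in the hyperplane `v⊥`. One
    -- inclusion rests on `A⊆A*`, the other on `A*-decompose`.
    projection-translate : ∀ i {w} → w ∈ H n → w i ≈ 0# →
      IsTranslateOf (Projection (v n i) (v⊥ n i) (L n i w)) (Projection (v n i) (v⊥ n i) (A* n))
    projection-translate i {w} w∈H wᵢ≈0 = w , λ y → mk⇔ (to y) (from y)
      where
      to : ∀ y → y ∈ Projection (v n i) (v⊥ n i) (L n i w) →
           ∃[ t ] (t ∈ Projection (v n i) (v⊥ n i) (A* n) × y ≈ᵛ w +ᵛ t)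
      to y (x , (a , a∈A , s , x≈) , (t , y≈) , y∈H , yᵢ≈0) =
        y -ᵛ w , (a , A⊆A* a∈A , (s + t , λ k → begin
            y k - w k
              ≈⟨ +-congʳ (trans (y≈ k) (+-congʳ (x≈ k))) ⟩
            w k + a k + s * v n i k + t * v n i k
              - w k          ≈⟨ solve 5 (λ w a s t v → w :+ a :+ s :* v :+ t :* v :- w
              := a :+ (s :+ t) :* v) refl (w k) (a k) s t (v n i k) ⟩
            a k + (s + t) * v n i k                              ∎)
          , trans (sum-- y w) (trans (+-cong y∈H (-‿cong w∈H)) (-‿inverseʳ 0#))
          , trans (+-cong yᵢ≈0 (-‿cong wᵢ≈0)) (-‿inverseʳ 0#))
        , λ k → solve 2 (λ y w → y := w :+ (y :- w)) refl (y k) (w k)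

      from : ∀ y → ∃[ t ] (t ∈ Projection (v n i) (v⊥ n i) (A* n) × y ≈ᵛ w +ᵛ t) →
             y ∈ Projection (v n i) (v⊥ n i) (L n i w)
      from y (t , (x , x∈A* , (r , t≈) , t∈H , tᵢ≈0) , y≈) = case A*-decompose i x∈A* of λ
        (a , a∈A , s , x≈) →
        w +ᵛ a , (a , a∈A , 0# , λ k → solve 2 (λ b v → b
          := b :+ con (+ 0) :* v) refl (w k + a k) (v n i k))
        , (s + r , λ k → begin
            y k
              ≈⟨ trans (y≈ k) (+-congˡ (trans (t≈ k) (+-congʳ (x≈ k)))) ⟩
            w k + (a k + s * v n i k + r * v n i k)
              ≈⟨ solve 5 (λ w a s t v → w :+ (a :+ s :* v :+ t :* v)
              := w :+ a :+ (s :+ t) :* v) refl (w k) (a k) s r (v n i k) ⟩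
            w k + a k + (s + r) * v n i k                        ∎)
        , trans (sum-cong-≋ y≈) (trans (∑-distrib-+ w t) (trans (+-cong w∈H t∈H) (+-identityʳ 0#)))
        , trans (y≈ i) (trans (+-cong wᵢ≈0 tᵢ≈0) (+-identityʳ 0#))

    A-+ : ∀ {x y} → x ∈ A n → y ∈ A n → x +ᵛ y ∈ A n
    A-+ {x} {y} (x∈H , ix) (y∈H , iy) = trans (∑-distrib-+ x y)
      (trans (+-cong x∈H y∈H) (+-identityʳ 0#)) ,
      λ k → isInteger-+ (ix k) (iy k)

    0ᵛ∈A : (λ _ → 0#) ∈ A n
    0ᵛ∈A = trans (sum-const (suc n) 0#) (zeroʳ _) , λ _ → isInteger-fromℕ 0

  A-extend : ∀ {n} {i j : Fin (suc (suc n))} (i≢j : i ≢ j) {z : Vector Carrier n} →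
    (∀ k → IsInteger (z k)) →
             ∃[ a ] (a ∈ A (suc n) × removeTwo i≢j a ≈ᵛ z)
  A-extend {n} {i} {j} i≢j {z} iz = a , (a∈H , ia) , remove-a
    where
    a : Vector Carrier (suc (suc n))
    -- Coordinate j is set to 0 and coordinate i balances the sum; the distance of the lines is
    -- insensitive to both.
    a = insertAt (insertAt z (punchOut i≢j) 0#) i (- sum z)

    aᵢ : a i ≈ - sum z
    aᵢ = reflexive (insertAt-lookup (insertAt z (punchOut i≢j) 0#) i (- sum z))

    aⱼ : a j ≈ 0#
    aⱼ = reflexive (≡.trans (≡.cong a (≡.sym (Fin.punchIn-punchOut i≢j)))
      (≡.trans (insertAt-punchIn (insertAt z (punchOut i≢j) 0#) i (- sum z) (punchOut i≢j))
        (insertAt-lookup z (punchOut i≢j) 0#)))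

    remove-a : removeTwo i≢j a ≈ᵛ z
    remove-a k = reflexive (≡.trans (insertAt-punchIn (insertAt z (punchOut i≢j) 0#) i (- sum z)
      (punchIn (punchOut i≢j) k))
      (insertAt-punchIn z (punchOut i≢j) 0# k))

    a∈H : a ∈ H (suc n)
    a∈H = begin
      sum a                                   ≈⟨ sum-removeTwo i≢j a ⟩
      a i + (a j + sum (removeTwo i≢j a))     ≈⟨ +-cong aᵢ (+-cong aⱼ (sum-cong-≋ remove-a)) ⟩
      - sum z + (0# + sum z)                  ≈⟨ solve 1 (λ s → :- s :+ (con (+ 0) :+ s)
        := con (+ 0)) refl (sum z) ⟩
      0#                                      ∎

    ia : ∀ k → IsInteger (a k)
    ia = other-elim i≢j (isInteger-resp (sym aᵢ) (isInteger-neg (isInteger-sum iz)))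
      (isInteger-resp (sym aⱼ) (isInteger-fromℕ 0))
      (λ k → isInteger-resp (sym (remove-a k)) (iz k))

-- Distances between lines of two directions

module LineDistance {c ℓ₁ ℓ₂ : Level} (R : Reals c ℓ₁ ℓ₂) (p : ℕ) {i j : Fin (suc (suc (suc p)))}
  (i≢j : i ≢ j) where
  open Reals R hiding (zero)
  open OrderedField R
  open Euclidean R
  open Integers R
  open SquareRoot R
  open Sums R
  open Dispersion R
  open Extremal R
  open Lattice R
  open SetoidReasoning setoid

  private
    m n : ℕ
    m = suc p
    n = suc m
    M = fromℕ m
    ν = ⅟ suc n
    vᵢ = v n i
    vⱼ = v n j

    norm² : ∀ {k} → Vector Carrier k → Carrier
    norm² e = sum (λ k → e k * e k)

    -- Splits the norm into the dispersion, which sliding along the lines cannot change, and three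
    -- squares, which it can make vanish. The lower bound and its attainment both follow.
    M*norm² : ∀ (e : Vector Carrier (suc n)) → let r = removeTwo i≢j e in
              M * norm² e ≈ dispersion r + (M * (e i * e i) + M * (e j * e j) + sum r * sum r)
    M*norm² e = trans (*-congˡ (sum-removeTwo i≢j (λ k → e k * e k)))
      (solve 5 (λ M a b t s → M :* (a :+ (b :+ t))
        := M :* t :- s :* s :+ (M :* a :+ M :* b :+ s :* s)) refl
        M (e i * e i) (e j * e j) (norm² (removeTwo i≢j e)) (sum (removeTwo i≢j e)))

    -- Away from the coordinates i and j both directions are constantly `- ν`, so sliding along the
    -- lines only adds a constant.
    dispersion-removeTwo : ∀ {x y Δ : Vector Carrier (suc n)} {t s} →
      x -ᵛ y ≈ᵛ Δ +ᵛ (t *ᵛ vᵢ -ᵛ s *ᵛ vⱼ) →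
                           dispersion (removeTwo i≢j (x -ᵛ y)) ≈ dispersion (removeTwo i≢j Δ)
    dispersion-removeTwo {Δ = Δ} {t} {s} x-y≈ = trans (dispersion-cong λ k → begin
      _                                         ≈⟨ x-y≈ (other i≢j k) ⟩
      Δ (other i≢j k) + (t * vᵢ (other i≢j k) - s * vⱼ (other i≢j k))
        ≈⟨ +-congˡ (+-cong (*-congˡ (v-off-diagonal n (λ eq → other≢i i≢j k (≡.sym eq))))
             (-‿cong (*-congˡ (v-off-diagonal n (λ eq → other≢j i≢j k (≡.sym eq)))))) ⟩
      Δ (other i≢j k) + (t * - ν - s * - ν)     ≈⟨ +-comm _ _ ⟩
      (t * - ν - s * - ν) + Δ (other i≢j k)     ∎)
      (dispersion-translate (t * - ν - s * - ν) (removeTwo i≢j Δ))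

  module _ (w z : Vector Carrier (suc n)) where
    private
      Δ = w -ᵛ z

    dispersion≤norm² : ∀ x y → x ∈ Line w vᵢ → y ∈ Line z vⱼ → dispersion (removeTwo i≢j Δ)
      ≤ M * norm² (x -ᵛ y)
    dispersion≤norm² x y (t , x≈) (s , y≈) = 0≤-⇒≤ (≤-respʳ (begin
      rest                                     ≈⟨ solve 2 (λ a b → b
        := a :+ b :- a) refl (dispersion r) rest ⟩
      dispersion r + rest - dispersion r
        ≈⟨ +-cong (sym (M*norm² (x -ᵛ y))) (-‿cong (dispersion-removeTwo {x} {y} {Δ} x-y≈)) ⟩
      M * norm² (x -ᵛ y) - dispersion (removeTwo i≢j Δ) ∎)
      (0≤-+ (0≤-+ (0≤-* (0≤fromℕ m) (0≤x² (x i - y i))) (0≤-* (0≤fromℕ m) (0≤x² (x j - y j))))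
        (0≤x² (sum r))))
      where
      r = removeTwo i≢j (x -ᵛ y)
      rest = M * ((x i - y i) * (x i - y i)) + M * ((x j - y j) * (x j - y j)) + sum r * sum r
      x-y≈ : x -ᵛ y ≈ᵛ Δ +ᵛ (t *ᵛ vᵢ -ᵛ s *ᵛ vⱼ)
      x-y≈ k = trans (+-cong (x≈ k) (-‿cong (y≈ k)))
        (solve 4 (λ w a z b → w :+ a :- (z :+ b)
          := w :- z :+ (a :- b)) refl (w k) (t * vᵢ k) (z k) (s * vⱼ k))

    -- The feet x and y of the common perpendicular: x - y vanishes in the
    -- coordinates i and j, and its remaining coordinates sum to 0.
    norm²-attained : Δ ∈ H n → ∃[ x ] ∃[ y ] (x ∈ Line w vᵢ × y ∈ Line z vⱼ ×
                     M * norm² (x -ᵛ y) ≈ dispersion (removeTwo i≢j Δ))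
    norm²-attained Δ∈H = x , y , (t , λ _ → refl) , (s , λ _ → refl) , (begin
      M * norm² e
        ≈⟨ M*norm² e ⟩
      dispersion r + (M * (e i * e i) + M * (e j * e j) + sum r * sum r)
        ≈⟨ +-cong (dispersion-removeTwo {x} {y} {Δ} e≈)
           (+-cong (+-cong (*-congˡ (*-cong eᵢ≈0 eᵢ≈0)) (*-congˡ (*-cong eⱼ≈0 eⱼ≈0)))
           (*-cong Σr≈0 Σr≈0)) ⟩
      dispersion (removeTwo i≢j Δ) + (M * (0# * 0#) + M * (0# * 0#) + 0# * 0#)
        ≈⟨ solve 2 (λ w M → w :+ (M :* (con (+ 0) :* con (+ 0)) :+ M :* (con (+ 0) :* con (+ 0)) :+
           con (+ 0) :* con (+ 0)) := w) refl (dispersion (removeTwo i≢j Δ)) M ⟩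
      dispersion (removeTwo i≢j Δ) ∎)
      where
      S = sum (removeTwo i≢j Δ)
      -- The equations eᵢ = 0 and eⱼ = 0 share the term (t - s) ν. Presuming that it equals `mean`
      -- determines `t` and `s`; `shift≈mean` then confirms it, because Δ sums to 0 and m + 2 = n +
      -- 1.
      mean = ⅟ m * S
      t = mean - Δ i
      s = Δ j - mean
      x = w +ᵛ t *ᵛ vᵢ
      y = z +ᵛ s *ᵛ vⱼ
      e = x -ᵛ y
      r = removeTwo i≢j e

      e≈ : e ≈ᵛ Δ +ᵛ (t *ᵛ vᵢ -ᵛ s *ᵛ vⱼ)
      e≈ k = solve 4 (λ w a z b → w :+ a :- (z :+ b)
        := w :- z :+ (a :- b)) refl (w k) (t * vᵢ k) (z k) (s * vⱼ k)

      M*mean≈S : M * mean ≈ S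
      M*mean≈S = trans (solve 3 (λ M i s → M :* (i :* s) := i :* M :* s) refl M (⅟ m) S)
        (trans (*-congʳ (⅟-inverse m)) (*-identityˡ S))

      shift≈mean : (t - s) * ν ≈ mean
      shift≈mean = begin
        (t - s) * ν
          ≈⟨ solve 5 (λ c a b ν s → ((c :- a) :- (b :- c)) :* ν
             := (con (+ 2) :* c :+ s :- (a :+ (b :+ s))) :* ν) refl mean (Δ i) (Δ j) ν S ⟩
        (fromℕ 2 * mean + S - (Δ i + (Δ j + S))) * ν
          ≈⟨ *-congʳ (+-cong (+-congˡ M*mean≈S) (-‿cong (sum-removeTwo i≢j Δ))) ⟨
        (fromℕ 2 * mean + M * mean - sum Δ) * ν
          ≈⟨ *-congʳ (+-congˡ (-‿cong Δ∈H)) ⟩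
        (fromℕ 2 * mean + M * mean - 0#) * ν
          ≈⟨ solve 3 (λ c M ν → (con (+ 2) :* c :+ M :* c :- con (+ 0)) :* ν
             := ν :* (con (+ 1) :+ (con (+ 1) :+ M)) :* c) refl mean M ν ⟩
        ν * fromℕ (suc n) * mean
          ≈⟨ trans (*-congʳ (⅟-inverse (suc n))) (*-identityˡ mean) ⟩
        mean ∎

      eᵢ≈0 : e i ≈ 0#
      eᵢ≈0 = begin
        e i                                     ≈⟨ e≈ i ⟩
        Δ i + (t * vᵢ i - s * vⱼ i)
          ≈⟨ +-congˡ (+-cong (*-congˡ (v-diagonal n i))
          (-‿cong (*-congˡ (v-off-diagonal n (i≢j ∘ ≡.sym))))) ⟩
        Δ i + (t * (1# - ν) - s * - ν)
          ≈⟨ solve 4 (λ d t s ν → d :+ (t :* (con (+ 1) :- ν) :- s :* :- ν)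
          := d :+ t :- (t :- s) :* ν) refl (Δ i) t s ν ⟩
        Δ i + t - (t - s) * ν                   ≈⟨ +-congˡ (-‿cong shift≈mean) ⟩
        Δ i + (mean - Δ i) - mean               ≈⟨ solve 2 (λ d c → d :+ (c :- d) :- c
          := con (+ 0)) refl (Δ i) mean ⟩
        0#                                      ∎

      eⱼ≈0 : e j ≈ 0#
      eⱼ≈0 = begin
        e j                                     ≈⟨ e≈ j ⟩
        Δ j + (t * vᵢ j - s * vⱼ j)
          ≈⟨ +-congˡ (+-cong (*-congˡ (v-off-diagonal n i≢j)) (-‿cong (*-congˡ (v-diagonal n j)))) ⟩
        Δ j + (t * - ν - s * (1# - ν))
          ≈⟨ solve 4 (λ d t s ν → d :+ (t :* :- ν :- s :* (con (+ 1) :- ν))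
          := d :- s :- (t :- s) :* ν) refl (Δ j) t s ν ⟩
        Δ j - s - (t - s) * ν                   ≈⟨ +-congˡ (-‿cong shift≈mean) ⟩
        Δ j - (Δ j - mean) - mean               ≈⟨ solve 2 (λ d c → d :- (d :- c) :- c
          := con (+ 0)) refl (Δ j) mean ⟩
        0#                                      ∎

      sum-e : sum e ≈ 0#
      sum-e = begin
        sum e
          ≈⟨ sum-cong-≋ e≈ ⟩
        sum (Δ +ᵛ (t *ᵛ vᵢ -ᵛ s *ᵛ vⱼ))
          ≈⟨ trans (∑-distrib-+ Δ (t *ᵛ vᵢ -ᵛ s *ᵛ vⱼ)) (+-congˡ (sum-- (t *ᵛ vᵢ) (s *ᵛ vⱼ))) ⟩
        sum Δ + (sum (t *ᵛ vᵢ) - sum (s *ᵛ vⱼ))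
          ≈⟨ +-cong Δ∈H (+-cong (sum-*v t i) (-‿cong (sum-*v s j))) ⟩
        0# + (0# - 0#)
          ≈⟨ solve 0 (con (+ 0) :+ (con (+ 0) :- con (+ 0)) := con (+ 0)) refl ⟩
        0# ∎
        where
        sum-*v : ∀ t i → sum (t *ᵛ v n i) ≈ 0#
        sum-*v t i = trans (sym (*-distribˡ-sum t (v n i))) (trans (*-congˡ (sum-v n i)) (zeroʳ t))

      Σr≈0 : sum r ≈ 0#
      Σr≈0 = begin
        sum r                       ≈⟨ solve 1 (λ s → s
          := con (+ 0) :+ (con (+ 0) :+ s)) refl (sum r) ⟩
        0# + (0# + sum r)           ≈⟨ +-cong eᵢ≈0 (+-congʳ eⱼ≈0) ⟨
        e i + (e j + sum r)         ≈⟨ sum-removeTwo i≢j e ⟨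
        sum e                       ≈⟨ sum-e ⟩
        0#                          ∎

    lineDistance : Δ ∈ H n → ∀ {d} → 0# ≤ d → M * (d * d) ≈ dispersion (removeTwo i≢j Δ) →
                   IsSetDistance (Line w vᵢ) (Line z vⱼ) d
    lineDistance Δ∈H {d} 0≤d Md²≈ = lower , λ b b≤ →
      case norm²-attained Δ∈H of λ (x , y , x∈ , y∈ , attained) →
      b≤ d (x , y , x∈ , y∈ , 0≤d , M-cancel (trans Md²≈ (sym attained)))
      where
      M-cancel : ∀ {a b} → M * a ≈ M * b → a ≈ b
      M-cancel Ma≈Mb = ≤-antisym (*-cancelˡ-≤ (0<fromℕ p) (≤-reflexive Ma≈Mb))
        (*-cancelˡ-≤ (0<fromℕ p) (≤-reflexive (sym Ma≈Mb)))
      lower : LowerBound _ d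
      lower d′ (x , y , x∈ , y∈ , 0≤d′ , d′²≈) = square-cancel-≤ 0≤d′ (*-cancelˡ-≤ (0<fromℕ p)
        (≤-respˡ (sym Md²≈) (≤-respʳ (*-congˡ (sym d′²≈)) (dispersion≤norm² x y x∈ y∈))))

    lineDistance-exists : Δ ∈ H n → ∃[ d ] (0# ≤ d × M * (d * d) ≈ dispersion (removeTwo i≢j Δ))
    lineDistance-exists Δ∈H = case norm²-attained Δ∈H of λ (x , y , _ , _ , attained) →
      case squareRoot (0≤sum (λ k → 0≤x² (x k - y k))) of λ (d , 0≤d , d²≈) →
      d , 0≤d , trans (*-congˡ d²≈) attained

    -- The distance `d′` is given only as an infimum, so the estimate passes through its being the
    -- greatest lower bound.
    lineDistance-≥ : ∀ {d} → 0# ≤ d → M * (d * d) ≤ dispersion (removeTwo i≢j Δ) →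
                           ∀ {d′} → IsSetDistance (Line w vᵢ) (Line z vⱼ) d′ → d ≤ d′
    lineDistance-≥ {d} 0≤d Md²≤ (_ , greatest) = greatest d λ d′ (x , y , x∈ , y∈ , 0≤d′ , d′²≈) →
      square-cancel-≤ 0≤d′ (*-cancelˡ-≤ (0<fromℕ p)
        (≤-trans Md²≤ (≤-respʳ (*-congˡ (sym d′²≈)) (dispersion≤norm² x y x∈ y∈))))

  private
    difference∈H : ∀ w z a b → w ∈ H n → z ∈ H n → a ∈ A n → b ∈ A n → (w +ᵛ a) -ᵛ (z +ᵛ b) ∈ H n
    difference∈H w z a b w∈H z∈H (a∈H , _) (b∈H , _) = trans (sum-- (w +ᵛ a) (z +ᵛ b))
      (trans (+-cong (trans (∑-distrib-+ w a) (+-cong w∈H a∈H))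
        (-‿cong (trans (∑-distrib-+ z b) (+-cong z∈H b∈H))))
      (solve 0 (con (+ 0) :+ con (+ 0) :- (con (+ 0) :+ con (+ 0)) := con (+ 0)) refl))

  module _ {D : Carrier} (0≤D : 0# ≤ D) (D²≈ : fromℕ 12 * (M * (D * D)) ≈ M * M - 1#) where

    private
      0<12 = 0<fromℕ 11

    uniform-minimalLineDistance : ∀ w z → w ∈ H n → z ∈ H n →
      UniformModOne (removeTwo i≢j (w -ᵛ z)) →
                                  IsMinimalLineDistance n i j w z D
    uniform-minimalLineDistance w z w∈H z∈H uniform = attained , lower
      where
      nearest = uniform-dispersion-attained {y = removeTwo i≢j (w -ᵛ z)} uniform
      t = proj₁ nearest
      extension = A-extend i≢j (proj₁ (proj₂ nearest))
      a = proj₁ extension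
      a∈A = proj₁ (proj₂ extension)

      D-attained : fromℕ 12 * (M * (D * D)) ≈ fromℕ 12
        * dispersion (removeTwo i≢j ((w +ᵛ a) -ᵛ (z +ᵛ (λ _ → 0#))))
      D-attained = begin
        fromℕ 12 * (M * (D * D))                               ≈⟨ D²≈ ⟩
        M * M - 1#                                             ≈⟨ proj₂ (proj₂ nearest) ⟨
        fromℕ 12 * dispersion (removeTwo i≢j (w -ᵛ z) +ᵛ t)    ≈⟨ *-congˡ (dispersion-cong {m} λ k →
          trans (+-congˡ (sym (proj₂ (proj₂ extension) k)))
            (solve 3 (λ w z a → w :- z :+ a := w :+ a :- (z :+ con (+ 0))) refl (w (other i≢j k))
              (z (other i≢j k)) (a (other i≢j k)))) ⟩
        fromℕ 12 * dispersion (removeTwo i≢j ((w +ᵛ a) -ᵛ (z +ᵛ (λ _ → 0#)))) ∎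

      attained : ∃[ a ] ∃[ b ] (a ∈ A n × b ∈ A n × IsSetDistance (Line (w +ᵛ a) vᵢ)
        (Line (z +ᵛ b) vⱼ) D)
      -- Only the difference of the two lattice vectors matters, so one of them may be 0.
      attained = a , (λ _ → 0#) , a∈A , 0ᵛ∈A n ,
        lineDistance (w +ᵛ a) (z +ᵛ (λ _ → 0#)) (difference∈H w z a (λ _ → 0#) w∈H z∈H a∈A (0ᵛ∈A n))
          0≤D (≤-antisym
          (*-cancelˡ-≤ 0<12 (≤-reflexive D-attained))
            (*-cancelˡ-≤ 0<12 (≤-reflexive (sym D-attained))))

      lower : LowerBound _ D
      lower d′ (a , b , (_ , ia) , (_ , ib) , distance) = lineDistance-≥ (w +ᵛ a) (z +ᵛ b) 0≤D
        (*-cancelˡ-≤ 0<12 (≤-respˡ (sym D²≈) (≤-respʳ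
          (*-congˡ (dispersion-cong {m} (λ k → solve 4 (λ w z a b → w :- z :+ (a :- b)
            := w :+ a :- (z :+ b)) refl
            (w (other i≢j k)) (z (other i≢j k)) (a (other i≢j k)) (b (other i≢j k)))))
          (uniform-dispersion-≥ {y = removeTwo i≢j (w -ᵛ z)} {removeTwo i≢j (a -ᵛ b)} uniform
            (λ k → isInteger-- (ia (other i≢j k)) (ib (other i≢j k))))))) distance

    -- The pair of lines attaining the minimum yields a `Δ` that is minimal modulo integers, to
    -- which `dispersion-≤` applies. As `d` is only known as an infimum, it is compared in both
    -- directions with the explicit distance `d₀` of the same pair.
    attainable-≤ : UpperBound (AttainableMinimalDistance n i j) D
    attainable-≤ d (w , z , w∈H , z∈H , _ , _ , (a , b , a∈A , b∈A , below , greatest) , minimal) =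
      ≤-trans d≤d₀ (square-cancel-≤ 0≤D (*-cancelˡ-≤ (0<fromℕ p) (*-cancelˡ-≤ 0<12
        (≤-respˡ (*-congˡ (sym Md₀²≈)) (≤-respʳ (sym D²≈)
          (dispersion-≤ {x = removeTwo i≢j Δ} latticeMinimal))))))
      where
      Δ = (w +ᵛ a) -ᵛ (z +ᵛ b)
      nearest = lineDistance-exists (w +ᵛ a) (z +ᵛ b) (difference∈H w z a b w∈H z∈H a∈A b∈A)
      d₀ = proj₁ nearest
      0≤d₀ = proj₁ (proj₂ nearest)
      Md₀²≈ = proj₂ (proj₂ nearest)
      d₀-distance = lineDistance (w +ᵛ a) (z +ᵛ b) (difference∈H w z a b w∈H z∈H a∈A b∈A) 0≤d₀ Md₀²≈

      d≤d₀ : d ≤ d₀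
      d≤d₀ = minimal d₀ (a , b , a∈A , b∈A , d₀-distance)

      d₀≤d : d₀ ≤ d
      d₀≤d = greatest d₀ (proj₁ d₀-distance)

      latticeMinimal : IsLatticeMinimal (removeTwo i≢j Δ)
      latticeMinimal t it = ≤-respˡ Md₀²≈ (≤-respʳ Md₁²≈ (*-monoˡ-≤ (0≤fromℕ m) (square-mono-≤ 0≤d₀
        (≤-trans d₀≤d (minimal d₁ (a +ᵛ a′ , b , a+a′∈A , b∈A , d₁-distance))))))
        where
        extension = A-extend i≢j it
        a′ = proj₁ extension
        a+a′∈A = A-+ n {a} {a′} a∈A (proj₁ (proj₂ extension))
        next = lineDistance-exists (w +ᵛ (a +ᵛ a′)) (z +ᵛ b)
          (difference∈H w z (a +ᵛ a′) b w∈H z∈H a+a′∈A b∈A)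
        d₁ = proj₁ next
        d₁-distance = lineDistance (w +ᵛ (a +ᵛ a′)) (z +ᵛ b)
          (difference∈H w z (a +ᵛ a′) b w∈H z∈H a+a′∈A b∈A) (proj₁ (proj₂ next))
          (proj₂ (proj₂ next))
        Md₁²≈ : M * (d₁ * d₁) ≈ dispersion (removeTwo i≢j Δ +ᵛ t)
        Md₁²≈ = trans (proj₂ (proj₂ next)) (dispersion-cong {m} λ k → trans
          (solve 4 (λ w a t y → w :+ (a :+ t) :- y
            := w :+ a :- y :+ t) refl (w (other i≢j k)) (a (other i≢j k)) (a′ (other i≢j k))
            ((z +ᵛ b) (other i≢j k)))
          (+-congˡ (proj₂ (proj₂ extension) k)))

-- Injections of a finite set into itself

-- If `y` were missed, punching it out would embed `Fin (suc n)` into `Fin n`.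
injective⇒surjective : ∀ {n} {g : Fin n → Fin n} → Injective _≡_ _≡_ g → ∀ y → ∃[ x ] (g x ≡ y)
injective⇒surjective {suc n} {g} injective y with Fin.any? (λ x → g x Fin.≟ y)
... | yes gx≡y = gx≡y
... | no  gx≢y = contradiction (Fin.injective⇒≤ {f = λ x → punchOut (λ eq → gx≢y (x , ≡.sym eq))}
        (λ eq → injective (Fin.punchOut-injective (λ eq → gx≢y (_ , ≡.sym eq))
          (λ eq → gx≢y (_ , ≡.sym eq)) eq))) ℕ.1+n≰n

injective⇒permutation : ∀ {n} (g : Fin n → Fin n) → Injective _≡_ _≡_ g →
  Σ[ π ∈ Permutation′ n ] (∀ k → π ⟨$⟩ʳ k ≡ g k)
injective⇒permutation g injective = permutation g (proj₁ ∘ surjective) (proj₂ ∘ surjective)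
  (λ x → injective (proj₂ (surjective (g x)))) , λ _ → ≡.refl
  where surjective = injective⇒surjective injective

injectiveBelow⇒permutation : ∀ {n} (h : Fin n → ℕ) → (∀ k → h k ℕ.< n) → Injective _≡_ _≡_ h →
                             Σ[ π ∈ Permutation′ n ] (∀ k → toℕ (π ⟨$⟩ʳ k) ≡ h k)
injectiveBelow⇒permutation h h< injective =
  case injective⇒permutation (λ k → fromℕ< (h< k))
    (λ eq → injective (Fin.fromℕ<-injective _ _ _ _ eq)) of λ (π , π≡) →
  π , λ k → ≡.trans (≡.cong toℕ (π≡ k)) (Fin.toℕ-fromℕ< (h< k))

-- Discrete logarithms of differences in the finite field

module DifferenceLog {f ℓ : Level} (F : CommutativeRing f ℓ) (isField : IsField F) {p : ℕ}
  (e : Enumeration F (suc (suc p)))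
  {α : CommutativeRing.Carrier F} (α≉0 : ¬ (CommutativeRing._≈_ F α (CommutativeRing.0# F)))
  {M : Fin (suc (suc p)) → Fin (suc (suc p)) → ℕ} (isLog : IsDifferenceLog F e α M) where
  open CommutativeRing F hiding (zero)
  open IntegerSolver F
  open SemiringExp semiring using (_^_; ^-homo-*; ^-assocʳ; ^-congʳ; ^-congˡ)
  open Bijection e using (to; injective; surjective)
  open SetoidReasoning setoid

  private
    m : ℕ
    m = suc p

  integral : ∀ {x y} → ¬ (x ≈ 0#) → x * y ≈ 0# → y ≈ 0#
  integral {x} {y} x≉0 xy≈0 = case proj₂ isField x x≉0 of λ (z , xz≈1) → begin
    y                ≈⟨ *-identityˡ y ⟨
    1# * y           ≈⟨ *-congʳ xz≈1 ⟨
    x * z * y        ≈⟨ solve 3 (λ x y z → x :* z :* y := z :* (x :* y)) refl x y z ⟩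
    z * (x * y)      ≈⟨ *-congˡ xy≈0 ⟩
    z * 0#           ≈⟨ zeroʳ z ⟩
    0#               ∎

  x-y≈0⇒x≈y : ∀ {x y} → x - y ≈ 0# → x ≈ y
  x-y≈0⇒x≈y {x} {y} x-y≈0 = begin
    x              ≈⟨ solve 2 (λ x y → x := x :- y :+ y) refl x y ⟩
    x - y + y      ≈⟨ +-congʳ x-y≈0 ⟩
    0# + y         ≈⟨ +-identityˡ y ⟩
    y              ∎

  *-cancelˡ : ∀ {x y z} → ¬ (x ≈ 0#) → x * y ≈ x * z → y ≈ z
  *-cancelˡ {x} {y} {z} x≉0 xy≈xz = x-y≈0⇒x≈y (integral x≉0 (begin
    x * (y - z)      ≈⟨ solve 3 (λ x y z → x :* (y :- z) := x :* y :- x :* z) refl x y z ⟩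
    x * y - x * z    ≈⟨ +-congʳ xy≈xz ⟩
    x * z - x * z    ≈⟨ -‿inverseʳ (x * z) ⟩
    0#               ∎))

  α^≉0 : ∀ k → ¬ (α ^ k ≈ 0#)
  α^≉0 zero    = proj₁ isField
  α^≉0 (suc k) α^k≈0 = α^≉0 k (integral α≉0 α^k≈0)

  difference≉0 : ∀ {i j} → i ≢ j → ¬ (to i - to j ≈ 0#)
  difference≉0 i≢j eq = i≢j (injective (x-y≈0⇒x≈y eq))

  log-< : ∀ {i j} → i ≢ j → M i j ℕ.< m
  log-< {i} {j} i≢j = s≤s (proj₁ (isLog i j i≢j))

  α^log : ∀ {i j} → i ≢ j → α ^ M i j ≈ to i - to j
  α^log {i} {j} i≢j = proj₂ (isLog i j i≢j)

  α^log-injective : ∀ {i j k} → i ≢ j → i ≢ k → α ^ M i j ≈ α ^ M i k → j ≡ k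
  α^log-injective {i} {j} {k} i≢j i≢k eq = injective (begin
    to j                    ≈⟨ solve 2 (λ a b → b := a :- (a :- b)) refl (to i) (to j) ⟩
    to i - (to i - to j)    ≈⟨ +-congˡ (-‿cong (trans (sym (α^log i≢j)) (trans eq (α^log i≢k)))) ⟩
    to i - (to i - to k)    ≈⟨ solve 2 (λ a b → a :- (a :- b) := b) refl (to i) (to k) ⟩
    to k                    ∎)

  log-injectiveʳ : ∀ {i j k} → i ≢ j → i ≢ k → M i j ≡ M i k → j ≡ k
  log-injectiveʳ i≢j i≢k eq = α^log-injective i≢j i≢k (^-congʳ α eq)

  log-injectiveˡ : ∀ {i j k} → i ≢ k → j ≢ k → M i k ≡ M j k → i ≡ j
  log-injectiveˡ {i} {j} {k} i≢k j≢k eq = injective (begin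
    to i                    ≈⟨ solve 2 (λ a b → a := a :- b :+ b) refl (to i) (to k) ⟩
    to i - to k + to k      ≈⟨ +-congʳ (trans (sym (α^log i≢k))
      (trans (^-congʳ α eq) (α^log j≢k))) ⟩
    to j - to k + to k      ≈⟨ solve 2 (λ a b → a :- b :+ b := a) refl (to j) (to k) ⟩
    to j                    ∎)

  -- Counting: the m indices other than `i` have m distinct logarithms below m, so every exponent
  -- occurs.
  log-surjective : ∀ i {s} → s ℕ.< m → ∃[ j ] (i ≢ j × M i j ≡ s)
  log-surjective i s<m = case injectiveBelow⇒permutation (λ k → M i (punchIn i k))
    (λ k → log-< (i≢ k))
    (λ eq → Fin.punchIn-injective i _ _ (log-injectiveʳ (i≢ _) (i≢ _) eq)) of λ (π , π≡) →
    punchIn i (π ⟨$⟩ˡ fromℕ< s<m) , i≢ _ ,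
    ≡.trans (≡.sym (π≡ _)) (≡.trans (≡.cong toℕ (Perm.inverseʳ π)) (Fin.toℕ-fromℕ< s<m))
    where
    i≢ : ∀ k → i ≢ punchIn i k
    i≢ k eq = Fin.punchInᵢ≢i i k (≡.sym eq)

  -- Each exponent below m is the logarithm of some a₀ - aⱼ. Equal powers therefore give equal
  -- differences, hence the same j and the same exponent; the order of α need not be known
  -- beforehand.
  α^-injective : ∀ {s t} → s ℕ.< m → t ℕ.< m → α ^ s ≈ α ^ t → s ≡ t
  α^-injective {s} {t} s<m t<m α^s≈α^t = case log-surjective zero s<m of λ (j , 0≢j , Mj≡s) →
    case log-surjective zero t<m of λ (k , 0≢k , Mk≡t) →
    ≡.trans (≡.sym Mj≡s) (≡.trans (≡.cong (M zero) (α^log-injective 0≢j 0≢k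
      (trans (^-congʳ α Mj≡s) (trans α^s≈α^t (sym (^-congʳ α Mk≡t)))))) Mk≡t)

  -- The m nonzero elements are the powers α⁰, …, αᵐ⁻¹, so αᵐ is one of them,
  -- and cancelling α shows that it can only be α⁰.
  α^m≈1 : α ^ m ≈ 1#
  α^m≈1 with surjective (to zero - α ^ m)
  ... | j , toj≈ = α^m≈ (M zero j) (log-< 0≢j) (trans (α^log 0≢j) difference≈)
    where
    difference≈ : to zero - to j ≈ α ^ m
    difference≈ = trans (+-congˡ (-‿cong (toj≈ ≡.refl)))
      (solve 2 (λ a b → a :- (a :- b) := b) refl (to zero) (α ^ m))
    0≢j : zero ≢ j
    0≢j 0≡j = α^≉0 m (begin
      α ^ m              ≈⟨ difference≈ ⟨
      to zero - to j     ≈⟨ +-congˡ (-‿cong (reflexive (≡.cong to 0≡j))) ⟨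
      to zero - to zero  ≈⟨ -‿inverseʳ (to zero) ⟩
      0#                 ∎)
    α^m≈ : ∀ s → s ℕ.< m → α ^ s ≈ α ^ m → α ^ m ≈ 1#
    α^m≈ zero    _    1≈α^m     = sym 1≈α^m
    α^m≈ (suc s) ss<m α^ss≈α^m = contradiction
      (≡.cong suc (α^-injective (ℕ.<⇒≤ ss<m) (ℕ.n<1+n p) (*-cancelˡ α≉0 α^ss≈α^m))) (ℕ.<⇒≢ ss<m)

  -- The exponent of (aᵢ - aₖ) / (aⱼ - aₖ).
  ratioLog : Fin (suc m) → Fin (suc m) → Fin (suc m) → ℕ
  ratioLog i j k = (M i k ℕ.+ (m ∸ M j k)) % m

  ratioLog-< : ∀ i j k → ratioLog i j k ℕ.< m
  ratioLog-< i j k = m%n<n (M i k ℕ.+ (m ∸ M j k)) m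

  α^% : ∀ k → α ^ (k % m) ≈ α ^ k
  α^% k = sym (begin
    α ^ k                              ≡⟨ ≡.cong (α ^_)
      (≡.trans (m≡m%n+[m/n]*n k m) (≡.cong (k % m ℕ.+_) (ℕ.*-comm (k ℕ./ m) m))) ⟩
    α ^ (k % m ℕ.+ m ℕ.* (k ℕ./ m))    ≈⟨ ^-homo-* α (k % m) (m ℕ.* (k ℕ./ m)) ⟩
    α ^ (k % m) * α ^ (m ℕ.* (k ℕ./ m)) ≈⟨ *-congˡ (^-assocʳ α m (k ℕ./ m)) ⟨
    α ^ (k % m) * (α ^ m) ^ (k ℕ./ m)  ≈⟨ *-congˡ (trans (^-congˡ (k ℕ./ m) α^m≈1) (1^ (k ℕ./ m))) ⟩
    α ^ (k % m) * 1#                   ≈⟨ *-identityʳ _ ⟩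
    α ^ (k % m)                        ∎)
    where
    1^ : ∀ k → 1# ^ k ≈ 1#
    1^ zero    = refl
    1^ (suc k) = trans (*-identityˡ _) (1^ k)

  α^ratioLog : ∀ {i j k} → i ≢ k → j ≢ k → α ^ ratioLog i j k * (to j - to k) ≈ to i - to k
  α^ratioLog {i} {j} {k} i≢k j≢k = begin
    α ^ ratioLog i j k * (to j - to k)
      ≈⟨ *-cong (trans (α^% (M i k ℕ.+ (m ∸ M j k))) (^-homo-* α (M i k) (m ∸ M j k)))
      (sym (α^log j≢k)) ⟩
    α ^ M i k * α ^ (m ∸ M j k) * α ^ M j k              ≈⟨ *-assoc _ _ _ ⟩
    α ^ M i k * (α ^ (m ∸ M j k) * α ^ M j k)
      ≈⟨ *-congˡ (^-homo-* α (m ∸ M j k) (M j k)) ⟨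
    α ^ M i k * α ^ (m ∸ M j k ℕ.+ M j k)
      ≈⟨ *-congˡ (trans (^-congʳ α (ℕ.m∸n+n≡m (ℕ.<⇒≤ (log-< j≢k)))) α^m≈1) ⟩
    α ^ M i k * 1#                                       ≈⟨ *-identityʳ _ ⟩
    α ^ M i k                                            ≈⟨ α^log i≢k ⟩
    to i - to k                                          ∎

  -- A ratio of 1 would force aᵢ = aⱼ. This keeps the residue 0 free for the last coordinate.
  ratioLog≢0 : ∀ {i j k} → i ≢ j → i ≢ k → j ≢ k → ratioLog i j k ≢ 0
  ratioLog≢0 {i} {j} {k} i≢j i≢k j≢k eq = i≢j
    (log-injectiveˡ i≢k j≢k (α^-injective (log-< i≢k) (log-< j≢k) (begin
    α ^ M i k                             ≈⟨ trans (α^log i≢k) (sym (α^ratioLog i≢k j≢k)) ⟩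
    α ^ ratioLog i j k * (to j - to k)    ≈⟨ *-congʳ (^-congʳ α eq) ⟩
    1# * (to j - to k)                    ≈⟨ trans (*-identityˡ _) (sym (α^log j≢k)) ⟩
    α ^ M j k                             ∎)))

  -- x ↦ (aᵢ - x) / (aⱼ - x) is a Möbius transformation.
  ratioLog-injective : ∀ {i j k l} → i ≢ j → i ≢ k → j ≢ k → i ≢ l → j ≢ l → ratioLog i j k
    ≡ ratioLog i j l → k ≡ l
  ratioLog-injective {i} {j} {k} {l} i≢j i≢k j≢k i≢l j≢l eq = injective
    (x-y≈0⇒x≈y (integral (difference≉0 i≢j) (begin
    (to i - to j) * (to k - to l)
      ≈⟨ solve 4 (λ i j k l → (i :- j) :* (k :- l)
         := (i :- k) :* (j :- l) :- (i :- l) :* (j :- k)) refl (to i) (to j) (to k) (to l) ⟩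
    (to i - to k) * (to j - to l) - (to i - to l) * (to j - to k)
      ≈⟨ +-cong (*-congʳ (α^ratioLog i≢k j≢k))
         (-‿cong (*-congʳ (trans (*-congʳ (^-congʳ α eq)) (α^ratioLog i≢l j≢l)))) ⟨
    α ^ ratioLog i j k * (to j - to k) * (to j - to l) - α ^ ratioLog i j k * (to j - to l)
      * (to j - to k)
      ≈⟨ solve 3 (λ r x y → r :* y :* x :- r :* x :* y
         := con (+ 0)) refl (α ^ ratioLog i j k) (to j - to l) (to j - to k) ⟩
    0# ∎)))

-- Uniform distribution of the differences of the vectors u

inject₁-elim : ∀ {n p} (P : Pred (Fin (suc n)) p) → (∀ i → P (inject₁ i)) → P (Fin.fromℕ n) → ∀ i →
  P i
inject₁-elim P Pinject Pfromℕ i with view i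
... | ‵fromℕ     = Pfromℕ
... | ‵inject₁ j = Pinject j

≢fromℕ⇒inject₁ : ∀ {n} (i : Fin (suc n)) → i ≢ Fin.fromℕ n → ∃[ j ] (i ≡ inject₁ j)
≢fromℕ⇒inject₁ = inject₁-elim _ (λ j _ → j , ≡.refl) (λ i≢i → contradiction ≡.refl i≢i)

module Uniform {c ℓ₁ ℓ₂ : Level} (R : Reals c ℓ₁ ℓ₂) where
  open Reals R hiding (zero)
  open OrderedField R
  open Integers R

  uniformModOne : ∀ {m} {y : Vector Carrier (suc m)} b (h : Fin (suc m) → ℕ) →
    (∀ k → h k ℕ.< suc m) → Injective _≡_ _≡_ h →
                  (∀ k → IsInteger (y k - (b + fromℕ (h k) / suc m))) → UniformModOne y
  uniformModOne {m} {y} b h h< injective near = case injectiveBelow⇒permutation h h< injective of λ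
    (π , π≡h) →
    -- `h` assigns a residue to each coordinate, whereas `UniformModOne` lists the coordinates by
    -- residue; hence the inverse permutation.
    b , Perm.flip π , λ k → isInteger-resp
      (+-congˡ (-‿cong (+-congˡ (*-congʳ (reflexive (≡.cong fromℕ
        (≡.trans (≡.sym (π≡h (π ⟨$⟩ˡ k))) (≡.cong toℕ (Perm.inverseʳ π)))))))))
      (near (π ⟨$⟩ˡ k))

module Arrangement {c ℓ₁ ℓ₂ f ℓ : Level} (R : Reals c ℓ₁ ℓ₂) (F : CommutativeRing f ℓ)
  (isField : IsField F) {p : ℕ} (e : Enumeration F (2+ p))
  {α : CommutativeRing.Carrier F} (α≉0 : ¬ (CommutativeRing._≈_ F α (CommutativeRing.0# F)))
  {M : Fin (2+ p) → Fin (2+ p) → ℕ} (isLog : IsDifferenceLog F e α M) where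
  open Reals R hiding (zero)
  open OrderedField R
  open Euclidean R
  open Integers R
  open Sums R
  open Dispersion R using (index; sum-index)
  open Lattice R using (sum-removeTwo)
  open Uniform R
  open DifferenceLog F isField e α≉0 isLog using
    (log-<; log-injectiveʳ; ratioLog; ratioLog-<; ratioLog≢0; ratioLog-injective)
  open SetoidReasoning setoid

  private
    m n : ℕ
    m = suc p
    n = suc m
    ½ = ⅟ 2
    ι = ⅟ m

    ½+½≈1 : ½ + ½ ≈ 1#
    ½+½≈1 = trans (solve 1 (λ h → h :+ h := h :* con (+ 2)) refl ½) (⅟-inverse 2)

    fromℕ-∸ : ∀ {a b} → b ℕ.≤ a → fromℕ (a ∸ b) + fromℕ b ≈ fromℕ a
    fromℕ-∸ {a} {b} b≤a = trans (sym (×-homo-+ 1# (a ∸ b) b))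
      (reflexive (≡.cong fromℕ (ℕ.m∸n+n≡m b≤a)))

    entry : ℕ → Carrier
    entry k = (fromℕ k + ½) / m - ½

    entry≈ : ∀ k → entry k ≈ (fromℕ k + ½) * ι - ½
    entry≈ k = +-congʳ (/≈*⅟ (fromℕ k + ½) m)

  u-fromℕˡ : ∀ j → u n M (Fin.fromℕ n) j ≈ 0#
  u-fromℕˡ j rewrite view-fromℕ n = refl

  u-fromℕʳ : ∀ i → u n M (inject₁ i) (Fin.fromℕ n) ≈ 0#
  u-fromℕʳ i rewrite view-inject₁ i | view-fromℕ n = refl

  u-diagonal : ∀ i → u n M (inject₁ i) (inject₁ i) ≈ 0#
  u-diagonal i rewrite view-inject₁ i with i Fin.≟ i
  ... | yes _   = refl
  ... | no  i≢i = contradiction ≡.refl i≢i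

  u-off-diagonal : ∀ {i j} → i ≢ j → u n M (inject₁ i) (inject₁ j) ≈ entry (M i j)
  u-off-diagonal {i} {j} i≢j rewrite view-inject₁ i | view-inject₁ j with i Fin.≟ j
  ... | yes i≡j = contradiction i≡j i≢j
  ... | no  _   = refl

  private
    inject₁≢fromℕ : ∀ {i : Fin n} → inject₁ i ≢ Fin.fromℕ n
    inject₁≢fromℕ eq = Fin.fromℕ≢inject₁ (≡.sym eq)

  -- The entries of the i-th row of u in columns other than the i-th and the last.
  module Row (i : Fin n) (l : Fin m → Fin (suc n)) (l≢i : ∀ k → l k ≢ inject₁ i)
    (l≢fromℕ : ∀ k → l k ≢ Fin.fromℕ n)
             (l-injective : Injective _≡_ _≡_ l) where

    column : Fin m → Fin n
    column k = proj₁ (≢fromℕ⇒inject₁ (l k) (l≢fromℕ k))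

    column≡ : ∀ k → l k ≡ inject₁ (column k)
    column≡ k = proj₂ (≢fromℕ⇒inject₁ (l k) (l≢fromℕ k))

    i≢column : ∀ k → i ≢ column k
    i≢column k eq = l≢i k (≡.trans (column≡ k) (≡.cong inject₁ (≡.sym eq)))

    column-injective : Injective _≡_ _≡_ column
    column-injective {k} {l} eq = l-injective
      (≡.trans (column≡ k) (≡.trans (≡.cong inject₁ eq) (≡.sym (column≡ l))))

    log : Fin m → ℕ
    log k = M i (column k)

    log<m : ∀ k → log k ℕ.< m
    log<m k = log-< (i≢column k)

    log-injective : Injective _≡_ _≡_ log
    log-injective eq = column-injective (log-injectiveʳ (i≢column _) (i≢column _) eq)

    u-row : ∀ k → u n M (inject₁ i) (l k) ≈ entry (log k)
    u-row k = trans (reflexive (≡.cong (u n M (inject₁ i)) (column≡ k)))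
      (u-off-diagonal (i≢column k))

  -- The logarithms in a row run once through 0, ..., m - 1, and the two halves in the entry (k +
  -- 1/2)/m - 1/2 make these values symmetric about 0.
  sum-u : ∀ i → u n M i ∈ H n
  sum-u = inject₁-elim _ sum-row (trans (sum-cong-≋ u-fromℕˡ)
    (trans (sum-const (suc n) 0#) (zeroʳ _)))
    where
    sum-row : ∀ i → u n M (inject₁ i) ∈ H n
    sum-row i = begin
      sum (u n M (inject₁ i))
        ≈⟨ sum-removeTwo inject₁≢fromℕ (u n M (inject₁ i)) ⟩
      u n M (inject₁ i) (inject₁ i) + (u n M (inject₁ i) (Fin.fromℕ n)
        + sum (removeTwo inject₁≢fromℕ (u n M (inject₁ i))))
        ≈⟨ +-cong (u-diagonal i) (+-cong (u-fromℕʳ i) (sum-cong-≋ u-row)) ⟩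
      0# + (0# + sum (λ k → entry (log k)))
        ≈⟨ solve 1 (λ s → con (+ 0) :+ (con (+ 0) :+ s) := s) refl _ ⟩
      sum (λ k → entry (log k))
        ≈⟨ sum-entries ⟩
      0# ∎
      where
      open Row i (other inject₁≢fromℕ) (other≢i inject₁≢fromℕ) (other≢j inject₁≢fromℕ)
        (other-injective inject₁≢fromℕ)
      all-entries : sum {m} (λ k → entry (toℕ k)) ≈ 0#
      all-entries = begin
        sum {m} (λ k → entry (toℕ k))
          ≈⟨ sum-cong-≋ {m} (λ k → trans (entry≈ (toℕ k)) (solve 3 (λ k h i → (k :+ h) :* i :- h
             := i :* k :+ (h :* i :- h)) refl (index k) ½ ι)) ⟩
        sum {m} (λ k → ι * index k + (½ * ι - ½))
          ≈⟨ trans (∑-distrib-+ {m} (λ k → ι * index k) (λ _ → ½ * ι - ½))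
             (+-cong (sym (*-distribˡ-sum ι (index {m}))) (sum-const m _)) ⟩
        ι * sum (index {m}) + fromℕ m * (½ * ι - ½)
          ≈⟨ +-congʳ (trans (sym (*-identityˡ _)) (*-congʳ (sym ½+½≈1))) ⟩
        (½ + ½) * (ι * sum (index {m})) + fromℕ m * (½ * ι - ½)
          ≈⟨ solve 4 (λ h i s M → (h :+ h) :* (i :* s) :+ M :* (h :* i :- h)
             := h :* i :* (con (+ 2) :* s) :+ M :* (h :* i :- h)) refl ½ ι (sum (index {m}))
             (fromℕ m) ⟩
        ½ * ι * (fromℕ 2 * sum (index {m})) + fromℕ m * (½ * ι - ½)
          ≈⟨ +-congʳ (*-congˡ (sum-index m)) ⟩
        ½ * ι * (fromℕ m * (fromℕ m - 1#)) + fromℕ m * (½ * ι - ½)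
          ≈⟨ solve 3 (λ h i M → h :* i :* (M :* (M :- con (+ 1))) :+ M :* (h :* i :- h)
             := h :* M :* (i :* M :- con (+ 1))) refl ½ ι (fromℕ m) ⟩
        ½ * fromℕ m * (ι * fromℕ m - 1#)
          ≈⟨ *-congˡ (trans (+-congʳ (⅟-inverse m)) (-‿inverseʳ 1#)) ⟩
        ½ * fromℕ m * 0#
          ≈⟨ zeroʳ _ ⟩
        0# ∎
      sum-entries : sum (λ k → entry (log k)) ≈ 0#
      sum-entries = case injectiveBelow⇒permutation log log<m log-injective of λ (π , π≡) →
        trans (sum-cong-≋ (λ k → reflexive (≡.cong entry (≡.sym (π≡ k)))))
          (trans (sym (sum-permute (λ k → entry (toℕ k)) π)) all-entries)

  uᵢᵢ≈0 : ∀ i → u n M i i ≈ 0#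
  uᵢᵢ≈0 = inject₁-elim _ u-diagonal (u-fromℕˡ (Fin.fromℕ n))

  private
    Claim : (i j : Fin (suc n)) → Set (c ⊔ ℓ₁)
    Claim i j = (i≢j : i ≢ j) → UniformModOne (removeTwo i≢j (u n M i -ᵛ u n M j))

    uniform-last : ∀ i → Claim (inject₁ i) (Fin.fromℕ n)
    uniform-last i i≢j = uniformModOne (½ * ι - ½) log log<m log-injective λ k →
      isInteger-resp (sym (begin
        u n M (inject₁ i) (other i≢j k) - u n M (Fin.fromℕ n) (other i≢j k)
          - (½ * ι - ½ + fromℕ (log k) / m)
          ≈⟨ +-cong (+-cong (trans (u-row k) (entry≈ (log k))) (-‿cong (u-fromℕˡ _)))
             (-‿cong (+-congˡ (/≈*⅟ (fromℕ (log k)) m))) ⟩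
        (fromℕ (log k) + ½) * ι - ½ - 0# - (½ * ι - ½ + fromℕ (log k) * ι)
          ≈⟨ solve 3 (λ k h i → (k :+ h) :* i :- h :- con (+ 0) :- (h :* i :- h :+ k :* i)
             := con (+ 0)) refl (fromℕ (log k)) ½ ι ⟩
        0# ∎)) (isInteger-fromℕ 0)
      where open Row i (other i≢j) (other≢i i≢j) (other≢j i≢j) (other-injective i≢j)

    -- Negation reverses the progression: the negative of `entry k` is `entry (p ∸ k)` for k ≤ p,
    -- because m = p + 1. The offset is therefore the same as for the opposite order of the two
    -- indices.
    last-uniform : ∀ j → Claim (Fin.fromℕ n) (inject₁ j)
    last-uniform j i≢j = uniformModOne (½ * ι - ½) (λ k → p ∸ log k) (λ k → s≤s (ℕ.m∸n≤m p (log k)))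
      (λ eq → log-injective (ℕ.∸-cancelˡ-≡ (log≤p _) (log≤p _) eq)) λ k →
      isInteger-resp (sym (begin
        u n M (Fin.fromℕ n) (other i≢j k) - u n M (inject₁ j) (other i≢j k)
          - (½ * ι - ½ + fromℕ (p ∸ log k) / m)
          ≈⟨ +-cong (+-cong (u-fromℕˡ _) (-‿cong (trans (u-row k) (entry≈ (log k)))))
             (-‿cong (+-congˡ (/≈*⅟ (fromℕ (p ∸ log k)) m))) ⟩
        0# - ((fromℕ (log k) + ½) * ι - ½) - (½ * ι - ½ + fromℕ (p ∸ log k) * ι)
          ≈⟨ solve 4 (λ k l h i → con (+ 0) :- ((k :+ h) :* i :- h) :- (h :* i :- h :+ l :* i)
             := (h :+ h) :- i :* ((h :+ h) :+ (l :+ k))) refl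
               (fromℕ (log k)) (fromℕ (p ∸ log k)) ½ ι ⟩
        (½ + ½) - ι * ((½ + ½) + (fromℕ (p ∸ log k) + fromℕ (log k)))
          ≈⟨ +-cong ½+½≈1 (-‿cong (*-congˡ (+-cong ½+½≈1 (fromℕ-∸ (log≤p k))))) ⟩
        1# - ι * fromℕ m
          ≈⟨ trans (+-congˡ (-‿cong (⅟-inverse m))) (-‿inverseʳ 1#) ⟩
        0# ∎)) (isInteger-fromℕ 0)
      where
      open Row j (other i≢j) (other≢j i≢j) (other≢i i≢j) (other-injective i≢j)
      log≤p : ∀ k → log k ℕ.≤ p
      log≤p k = ℕ.s≤s⁻¹ (log<m k)

    -- At the last coordinate both vectors vanish, so the residue is 0. This is the logarithm of the
    -- value 1 that the Möbius map takes at infinity.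
    residue : Fin n → Fin n → Fin (suc n) → ℕ
    residue i j k with view k
    ... | ‵fromℕ      = 0
    ... | ‵inject₁ k′ = ratioLog i j k′

    residue-fromℕ : ∀ i j → residue i j (Fin.fromℕ n) ≡ 0
    residue-fromℕ i j rewrite view-fromℕ n = ≡.refl

    residue-inject₁ : ∀ i j k → residue i j (inject₁ k) ≡ ratioLog i j k
    residue-inject₁ i j k rewrite view-inject₁ k = ≡.refl

    residue-< : ∀ i j k → residue i j k ℕ.< m
    residue-< i j k with view k
    ... | ‵fromℕ      = s≤s z≤n
    ... | ‵inject₁ k′ = ratioLog-< i j k′

    inject₁-≢ : ∀ {i k : Fin n} → inject₁ k ≢ inject₁ i → i ≢ k
    inject₁-≢ k≢i i≡k = k≢i (≡.cong inject₁ (≡.sym i≡k))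

    residue-injective : ∀ {i j} → i ≢ j → ∀ k l → k ≢ inject₁ i → k ≢ inject₁ j → l ≢ inject₁ i →
      l ≢ inject₁ j →
                        residue i j k ≡ residue i j l → k ≡ l
    residue-injective {i} {j} i≢j = inject₁-elim _
      (λ k → inject₁-elim _
        (λ l k≢i k≢j l≢i l≢j eq → ≡.cong inject₁
          (ratioLog-injective i≢j (inject₁-≢ k≢i) (inject₁-≢ k≢j) (inject₁-≢ l≢i) (inject₁-≢ l≢j)
            (≡.trans (≡.sym (residue-inject₁ i j k)) (≡.trans eq (residue-inject₁ i j l)))))
        (λ k≢i k≢j _ _ eq → contradiction
          (≡.trans (≡.sym (residue-inject₁ i j k)) (≡.trans eq (residue-fromℕ i j)))
          (ratioLog≢0 i≢j (inject₁-≢ k≢i) (inject₁-≢ k≢j))))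
      (inject₁-elim _
        (λ l _ _ l≢i l≢j eq → contradiction
          (≡.trans (≡.sym (residue-inject₁ i j l)) (≡.trans (≡.sym eq) (residue-fromℕ i j)))
          (ratioLog≢0 i≢j (inject₁-≢ l≢i) (inject₁-≢ l≢j)))
        (λ _ _ _ _ _ → ≡.refl))

    residue-near : ∀ i j k → k ≢ inject₁ i → k ≢ inject₁ j →
                   IsInteger (u n M (inject₁ i) k - u n M (inject₁ j) k
                     - (0# + fromℕ (residue i j k) / m))
    residue-near i j = inject₁-elim _ near λ _ _ → isInteger-resp (sym (begin
      u n M (inject₁ i) (Fin.fromℕ n) - u n M (inject₁ j) (Fin.fromℕ n)
        - (0# + fromℕ (residue i j (Fin.fromℕ n)) / m)
        ≈⟨ +-cong (+-cong (u-fromℕʳ i) (-‿cong (u-fromℕʳ j)))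
           (-‿cong (+-congˡ (trans (*-congʳ (reflexive (≡.cong fromℕ (residue-fromℕ i j))))
           (zeroˡ _)))) ⟩
      0# - 0# - (0# + 0#)
        ≈⟨ solve 0 (con (+ 0) :- con (+ 0) :- (con (+ 0) :+ con (+ 0)) := con (+ 0)) refl ⟩
      0# ∎)) (isInteger-fromℕ 0)
      where
      near : ∀ k → inject₁ k ≢ inject₁ i → inject₁ k ≢ inject₁ j →
             IsInteger (u n M (inject₁ i) (inject₁ k) - u n M (inject₁ j) (inject₁ k)
               - (0# + fromℕ (residue i j (inject₁ k)) / m))
      near k k≢i k≢j = isInteger-resp (sym (begin
        u n M (inject₁ i) (inject₁ k) - u n M (inject₁ j) (inject₁ k)
          - (0# + fromℕ (residue i j (inject₁ k)) / m)
          ≈⟨ +-cong (+-cong (trans (u-off-diagonal i≢k) (entry≈ (M i k)))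
             (-‿cong (trans (u-off-diagonal j≢k) (entry≈ (M j k)))))
               (-‿cong (+-congˡ (trans (*-congʳ (reflexive (≡.cong fromℕ (residue-inject₁ i j k))))
                 (/≈*⅟ (fromℕ h) m)))) ⟩
        (fromℕ (M i k) + ½) * ι - ½ - ((fromℕ (M j k) + ½) * ι - ½) - (0# + fromℕ h * ι)
          ≈⟨ solve 6 (λ a b h s i t → (a :+ s) :* i :- s :- ((b :+ s) :* i :- s) :-
             (con (+ 0) :+ h :* i) := (a :+ t :- h) :* i :- (t :+ b) :* i) refl
               (fromℕ (M i k)) (fromℕ (M j k)) (fromℕ h) ½ ι (fromℕ (m ∸ M j k)) ⟩
        (fromℕ (M i k) + fromℕ (m ∸ M j k) - fromℕ h) * ι - (fromℕ (m ∸ M j k) + fromℕ (M j k)) * ι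
          ≈⟨ +-cong (*-congʳ (+-congʳ division)) (-‿cong (*-congʳ (fromℕ-∸ (ℕ.<⇒≤ (log-< j≢k))))) ⟩
        (fromℕ h + fromℕ q * fromℕ m - fromℕ h) * ι - fromℕ m * ι
          ≈⟨ solve 4 (λ h q M i → (h :+ q :* M :- h) :* i :- M :* i
             := (i :* M) :* (q :- con (+ 1))) refl (fromℕ h) (fromℕ q) (fromℕ m) ι ⟩
        ι * fromℕ m * (fromℕ q - 1#)
          ≈⟨ trans (*-congʳ (⅟-inverse m)) (*-identityˡ _) ⟩
        fromℕ q - 1# ∎))
        (isInteger-- (isInteger-fromℕ q) (isInteger-resp (+-identityʳ 1#) (isInteger-fromℕ 1)))
        where
        i≢k = inject₁-≢ k≢i
        j≢k = inject₁-≢ k≢j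
        h = ratioLog i j k
        -- The discrepancy is the integer `q - 1`: reduction modulo m removes q m, and one m had
        -- been added to keep the exponent of the ratio nonnegative.
        q = (M i k ℕ.+ (m ∸ M j k)) ℕ./ m
        division : fromℕ (M i k) + fromℕ (m ∸ M j k) ≈ fromℕ h + fromℕ q * fromℕ m
        division = begin
          fromℕ (M i k) + fromℕ (m ∸ M j k)     ≈⟨ ×-homo-+ 1# (M i k) (m ∸ M j k) ⟨
          fromℕ (M i k ℕ.+ (m ∸ M j k))
            ≡⟨ ≡.cong fromℕ (m≡m%n+[m/n]*n (M i k ℕ.+ (m ∸ M j k)) m) ⟩
          fromℕ (h ℕ.+ q ℕ.* m)                 ≈⟨ ×-homo-+ 1# h (q ℕ.* m) ⟩
          fromℕ h + fromℕ (q ℕ.* m)             ≈⟨ +-congˡ (×1-homo-* q m) ⟩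
          fromℕ h + fromℕ q * fromℕ m           ∎

    uniform-inject : ∀ i j → Claim (inject₁ i) (inject₁ j)
    uniform-inject i j i≢j = uniformModOne 0# (λ k → residue i j (other i≢j k))
      (λ k → residue-< i j (other i≢j k))
      (λ {k} {l} eq → other-injective i≢j (residue-injective (λ i≡j → i≢j (≡.cong inject₁ i≡j))
        (other i≢j k) (other i≢j l)
        (other≢i i≢j k) (other≢j i≢j k) (other≢i i≢j l) (other≢j i≢j l) eq))
      (λ k → residue-near i j (other i≢j k) (other≢i i≢j k) (other≢j i≢j k))

  uniform-u : ∀ i j → Claim i j
  uniform-u = inject₁-elim _
    (λ i → inject₁-elim _ (uniform-inject i) (uniform-last i))
    (inject₁-elim _ last-uniform (λ i≢i → contradiction ≡.refl i≢i))

-- The optimal distance and the assembly of the theorem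

module _ {c ℓ₁ ℓ₂ : Level} (R : Reals c ℓ₁ ℓ₂) where
  open Reals R hiding (zero)
  open OrderedField R
  open Euclidean R
  open Sums R
  open SetoidReasoning setoid

  /-inverse : ∀ x k .{{_ : NonZero k}} → x / k * fromℕ k ≈ x
  /-inverse x k = begin
    x / k * fromℕ k            ≈⟨ *-congʳ (/≈*⅟ x k) ⟩
    x * ⅟ k * fromℕ k          ≈⟨ *-assoc _ _ _ ⟩
    x * (⅟ k * fromℕ k)        ≈⟨ *-congˡ (⅟-inverse k) ⟩
    x * 1#                     ≈⟨ *-identityʳ x ⟩
    x                          ∎

  0≤/ : ∀ {x} k .{{_ : NonZero k}} → 0# ≤ x → 0# ≤ x / k
  0≤/ {x} k 0≤x = ≤-respʳ (sym (/≈*⅟ x k)) (0≤-* 0≤x (0≤⅟ k))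

  -- With m = n - 1 the numerator n (n - 2) is m² - 1, so this is the extremal dispersion bound for
  -- a squared distance D², the dispersion being m D².
  optimalSquaredDistance≈ : ∀ p {D} → let m = fromℕ (suc p) in D * D ≈ optimalSquaredDistance (2+ p) →
                            fromℕ 12 * (m * (D * D)) ≈ m * m - 1#
  optimalSquaredDistance≈ p {D} D²≈ = begin
    fromℕ 12 * (m * (D * D))
      ≈⟨ solve 3 (λ t m d → t :* (m :* d) := d :* (t :* m)) refl (fromℕ 12) m (D * D) ⟩
    D * D * (fromℕ 12 * m)
      ≈⟨ *-cong D²≈ (sym (×1-homo-* 12 (suc p))) ⟩
    optimalSquaredDistance (2+ p) * fromℕ (12 ℕ.* suc p)
      ≈⟨ /-inverse (fromℕ (2+ p ℕ.* p)) (12 ℕ.* suc p) ⟩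
    fromℕ (2+ p ℕ.* p)
      ≈⟨ ×1-homo-* (2+ p) p ⟩
    fromℕ (2+ p) * fromℕ p
      ≈⟨ solve 1 (λ p → (con (+ 1) :+ (con (+ 1) :+ p)) :* p
         := (con (+ 1) :+ p) :* (con (+ 1) :+ p) :- con (+ 1)) refl (fromℕ p) ⟩
    m * m - 1# ∎
    where m = fromℕ (suc p)

  0≤optimalSquaredDistance : ∀ p → 0# ≤ optimalSquaredDistance (2+ p)
  0≤optimalSquaredDistance p = 0≤/ (12 ℕ.* suc p) (0≤fromℕ (2+ p ℕ.* p))

mainTheorem1 : {c ℓ₁ ℓ₂ f ℓ : Level} (R : Reals c ℓ₁ ℓ₂)
    (n : ℕ) .{{_ : NonTrivial n}} → PrimePower n →
    (F : CommutativeRing f ℓ) → IsField F →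
    (e : Enumeration F n) →
    (α : CommutativeRing.Carrier F) → IsPrimitiveElement F α →
    (M : Fin n → Fin n → ℕ) → IsDifferenceLog F e α M →
    let open Reals R
        open Euclidean R
    in
    ((i : Fin (suc n)) → u n M i ∈ H n × u n M i i ≈ 0#) ×
    ((i : Fin (suc n)) →
      IsTranslateOf (Projection (v n i) (v⊥ n i) (L n i (u n M i)))
                    (Projection (v n i) (v⊥ n i) (A* n))) ×
    ((i j : Fin (suc n)) (i≢j : i ≢ j) →
      UniformModOne (removeTwo i≢j (u n M i -ᵛ u n M j)) ×
      ∃[ D ] (IsSqrt (optimalSquaredDistance n) D ×
              IsMinimalLineDistance n i j (u n M i) (u n M j) D ×
              IsMaximum (AttainableMinimalDistance n i j) D))
mainTheorem1 R (2+ p) _ F isField e α (α≉0 , _) M isLog =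
  (λ i → sum-u i , uᵢᵢ≈0 i) ,
  (λ i → projection-translate (2+ p) i (sum-u i) (uᵢᵢ≈0 i)) ,
  λ i j i≢j → uniform-u i j i≢j , D , √q≈D , minimal i j i≢j ,
    (u (2+ p) M i , u (2+ p) M j , sum-u i , sum-u j , uᵢᵢ≈0 i , uᵢᵢ≈0 j , minimal i j i≢j) ,
    LineDistance.attainable-≤ R p i≢j (proj₁ √q≈D) 12mD²≈
  where
  open Reals R hiding (zero)
  open Euclidean R
  open Lattice R
  open SquareRoot R
  open Arrangement R F isField e α≉0 isLog

  √q : ∃ (IsSqrt (optimalSquaredDistance (2+ p)))
  √q = squareRoot (0≤optimalSquaredDistance R p)

  D = proj₁ √q
  √q≈D = proj₂ √q
  12mD²≈ = optimalSquaredDistance≈ R p {D} (proj₂ √q≈D)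

  minimal : ∀ i j → i ≢ j → IsMinimalLineDistance (2+ p) i j (u (2+ p) M i) (u (2+ p) M j) D
  minimal i j i≢j = LineDistance.uniform-minimalLineDistance R p i≢j (proj₁ √q≈D) 12mD²≈
    (u (2+ p) M i) (u (2+ p) M j) (sum-u i) (sum-u j) (uniform-u i j i≢j)
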